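{- Let $\mathcal{M}$ be a deterministic Turing machine with a single binary tape that computes in time $t$. Hasenjaeger's universal Turing machine $\mathcal{H}$ simulates the computation of $\mathcal{M}$ in time $O(t^3)$.
   Context: **Binary Turing machine.** A (deterministic, single-tape) binary Turing machine is a tuple $M=(Q,\{0,1\},f,q_0,q_{|Q|-1})$, where $Q$ is a finite set of states, $\{0,1\}$ is the tape alphabet, $0$ is the blank symbol, $q_0\in Q$ is the start state and $q_{|Q|-1}\in Q$ is the halt state. The transition function $f: Q\times\{0,1\}\to\{0,1\}\times\{L,R\}\times Q$ is undefined exactly on $\{q_{|Q|-1}\}\times\{0,1\}$. A rule $(q_i,x_1,x_2,D,q_j)$ means: in state $q_i$ reading $x_1$, write $x_2$, move the head one cell in direction $D$, and enter state $q_j$. The tape is bi-infinite and all but finitely many cells contain $0$. **Hasenjaeger's machine $\mathcal{H}$.** It is a three-tape machine with tapes $P$ (program), $C$ (counter), $W$ (work), each over $\{0,1\}$ with one two-way head. $P$ and $C$ are read-only, circular tapes of finite length; $W$ is a bi-infinite non-erasing tape ($1$ is never overwritten by $0$) with blank symbol $0$ and finitely many $1$s. The lengths and contents of $P$ and $C$ are fixed at the start of a computation. The states are $q_1,q_2,q_3,q_4$, with start state $q_1$. In each step, depending on the state and the three read symbols, the machine performs on each tape one of: move the head left ($L$), move the head right ($R$), do nothing ($-$), or, on $W$ only, write the symbol $1$; then it changes state. The transition rules, written (state; symbols read on $P,C,W$) $\mapsto$ (actions on $P,C,W$; next state), where $*$ means either symbol, are: 1. $(q_1;1,*,0)\mapsto(R,-,1;q_1)$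 2. $(q_1;1,*,1)\mapsto(R,-,-;q_1)$ 3. $(q_1;0,*,*)\mapsto(R,-,-;q_2)$ 4. $(q_2;1,0,*)\mapsto(R,-,R;q_1)$ 5. $(q_2;0,0,*)\mapsto(R,R,-;q_2)$ 6. $(q_2;1,1,*)\mapsto(R,L,L;q_1)$ 7. $(q_2;0,1,*)\mapsto(R,L,-;q_3)$ 8. $(q_3;0,*,0)\mapsto(R,-,-;q_3)$ 9. $(q_3;1,*,0)\mapsto(R,-,-;q_1)$ 10. $(q_3;0,*,1)\mapsto(R,R,-;q_3)$ 11. $(q_3;1,*,1)\mapsto(L,R,-;q_4)$ 12. $(q_4;0,1,*)\mapsto(L,-,-;q_4)$ 13. $(q_4;1,1,*)\mapsto(L,L,-;q_4)$ 14. $(q_4;*,0,*)\mapsto(R,-,-;q_1)$ **Configuration.** A configuration consists of the state, the tape contents and the head position(s). **Simulation.** $\mathcal{H}$ simulates the computation of $A$ in time $O(g(t))$ if there are contents of $P$ and $C$ and initial head positions on them depending only on $A$, an encoding $\varepsilon$ of initial configurations of $A$ as initial contents and head position of $W$, and a partial decoding $\delta$ from configurations of $\mathcal{H}$ to configurations of $A$, with $\varepsilon$ and $\delta$ computable by finite-state transducers acting on the $W$ (respectively $A$) tape contents with head position marked, such that for every initial configuration $c_0$ of $A$ with successive configurations $c_0,c_1,c_2,\ldots$, the run of $\mathcal{H}$ from the corresponding initial configuration passes, at times $s_0<s_1<s_2<\cdots$, through configurations decoding under $\delta$ to $c_0,c_1,c_2,\ldots$ respectively; halting of $A$ is signalled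 (see below) if and only if $A$ halts; and if $A$ runs in time $t$ then halting is signalled within $O(g(t))$ steps, with constant depending only on $A$. **Halting of $\mathcal{H}$.** $\mathcal{H}$ has no halt state. Halting of the simulated machine is signalled by $\mathcal{H}$ first reaching a designated pair (state, $P$-head position), from which point on $\mathcal{H}$ runs forever through a periodically repeating sequence of configurations with tape contents unchanged. **Time convention.** If a machine runs in time $t$, it halts within $t$ steps and uses at most $t$ tape cells (input cells included). -}

module Defs where

open import Data.Digit using (Bit)
open import Data.Fin using (Fin; fromℕ; toℕ)
open import Data.Fin.Patterns using (0F; 1F)
open import Data.Integer as ℤ using (ℤ; 0ℤ; 1ℤ; +_; -[1+_])
open import Data.List using (List; []; _∷_; _++_; _ʳ++_; map; last)
open import Data.Maybe using (Maybe; just; nothing; _>>=_; Is-just)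
open import Data.Nat using (ℕ; zero; suc; _+_; _*_; _≤_; _<_; NonZero)
open import Data.Nat.DivMod using (_mod_)
open import Data.Product using (_×_; _,_; ∃; ∃-syntax; Σ-syntax)
open import Data.Sum using (_⊎_; inj₁; inj₂)
open import Data.Unit using (⊤; tt)
open import Data.Vec using (Vec; lookup)
open import Function.Bundles using (_⇔_)
open import Relation.Binary.PropositionalEquality using (_≡_; _≢_)
open import Relation.Nullary using (¬_; yes; no)

-- Finiteness of the set of 1s is not a field here: it is exactly the
-- existence of a word describing the tape (see below), which is required of
-- every initial tape and preserved by every step.
record Tape : Set where
  constructor tape
  field
    cells : ℤ → Bit
    head  : ℤ

open Tape public

data Direction : Set where
  L R : Direction

read : Tape → Bit
read T = cells T (head T)

write : Bit → Tape → Tape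
write x (tape f h) = tape g h
  where
  g : ℤ → Bit
  g z with z ℤ.≟ h
  ... | yes _ = x
  ... | no  _ = f z

move : Direction → Tape → Tape
move L (tape f h) = tape f (h ℤ.- 1ℤ)
move R (tape f h) = tape f (h ℤ.+ 1ℤ)

-- A finite piece of tape with the head position marked; both sides are listed
-- starting from the cell adjacent to the head.
record Word : Set where
  constructor word
  field
    left  : List Bit
    under : Bit
    right : List Bit

nth : List Bit → ℕ → Bit
nth []       _       = 0F
nth (x ∷ _)  zero    = x
nth (_ ∷ xs) (suc n) = nth xs n

layout : Word → ℤ → Bit
layout (word l x r) (+ n)    = nth (x ∷ r) n
layout (word l x r) -[1+ n ] = nth l n

toTape : Word → Tape
toTape w = tape (layout w) 0ℤ

-- Relative to the head, so insensitive to translations of the whole tape.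
_describes_ : Word → Tape → Set
w describes T = ∀ z → cells T (head T ℤ.+ z) ≡ layout w z

-- The shortest description: no superfluous blanks at either end.
Trimmed : Word → Set
Trimmed (word l x r) = last l ≢ just 0F × last r ≢ just 0F

-- Tape contents as seen by a transducer: the letter under the head carries an
-- annotation from S (a machine state, or ⊤ if only the position is marked).
Letter : Set → Set
Letter S = Bit ⊎ (S × Bit)

spell : {S : Set} → S → Word → List (Letter S)
spell s (word l x r) = map inj₁ l ʳ++ (inj₂ (s , x) ∷ map inj₁ r)

record Transducer (I O : Set) : Set where
  field
    size  : ℕ
    start : Fin size
    next  : Fin size → I → Maybe (Fin size × List O)
    final : Fin size → Maybe (List O)

  runFrom : Fin size → List I → Maybe (List O)
  runFrom q []       = final q
  runFrom q (x ∷ xs) =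
    next q x       >>= λ (q′ , out) →
    runFrom q′ xs  >>= λ out′ →
    just (out ++ out′)

  run : List I → Maybe (List O)
  run = runFrom start

record Configuration (S : Set) : Set where
  constructor config
  field
    state : S
    work  : Tape

open Configuration public

record BinaryTM : Set where
  field
    lastState : ℕ

  State : Set
  State = Fin (suc lastState)

  q₀ : State
  q₀ = Fin.zero

  halt : State
  halt = fromℕ lastState

  field
    f           : State → Bit → Maybe (Bit × Direction × State)
    f-undefined : ∀ q x → (f q x ≡ nothing) ⇔ (q ≡ halt)

  Config : Set
  Config = Configuration State

  step : Config → Maybe Config
  step (config q T) =
    f q (read T) >>= λ (x , D , q′) →
    just (config q′ (move D (write x T)))

  trace : Config → ℕ → Maybe Config
  trace c zero    = just c
  trace c (suc i) = trace c i >>= step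

  HaltsAt : Config → ℕ → Set
  HaltsAt c i = ∃[ c′ ] trace c i ≡ just c′ × state c′ ≡ halt

  Halts : Config → Set
  Halts c = ∃ (HaltsAt c)

  InWindow : ℤ → ℕ → ℤ → Set
  InWindow a t z = a ℤ.≤ z × z ℤ.< a ℤ.+ + t

  -- The cells used (the input cells and those visited by the head) form an
  -- interval.
  UsesAtMost : Config → ℕ → Set
  UsesAtMost c t = ∃[ a ]
      (∀ z → cells (work c) z ≡ 1F → InWindow a t z)
    × (∀ i c′ → trace c i ≡ just c′ → InWindow a t (head (work c′)))

  RunsInTime : Config → ℕ → Set
  RunsInTime c t = (∃[ i ] i ≤ t × HaltsAt c i) × UsesAtMost c t

data HState : Set where
  q₁ q₂ q₃ q₄ : HState

data HeadAction : Set where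
  L R - : HeadAction

data WorkAction : Set where
  L R - 𝟙 : WorkAction

rule : HState → Bit → Bit → Bit → HeadAction × HeadAction × WorkAction × HState
rule q₁ 1F _  0F = R , - , 𝟙 , q₁
rule q₁ 1F _  1F = R , - , - , q₁
rule q₁ 0F _  _  = R , - , - , q₂
rule q₂ 1F 0F _  = R , - , R , q₁
rule q₂ 0F 0F _  = R , R , - , q₂
rule q₂ 1F 1F _  = R , L , L , q₁
rule q₂ 0F 1F _  = R , L , - , q₃
rule q₃ 0F _  0F = R , - , - , q₃
rule q₃ 1F _  0F = R , - , - , q₁
rule q₃ 0F _  1F = R , R , - , q₃
rule q₃ 1F _  1F = L , R , - , q₄
rule q₄ 0F 1F _  = L , - , - , q₄
rule q₄ 1F 1F _  = L , L , - , q₄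
rule q₄ _  0F _  = R , - , - , q₁

turn : ∀ {n} → HeadAction → Fin (suc n) → Fin (suc n)
turn {n} L i = (toℕ i + n) mod suc n
turn {n} R i = suc (toℕ i) mod suc n
turn     - i = i

act : WorkAction → Tape → Tape
act L = move L
act R = move R
act - = λ T → T
act 𝟙 = write 1F

module Hasenjaeger {m n : ℕ} (P : Vec Bit (suc m)) (C : Vec Bit (suc n)) where

  record HConfig : Set where
    constructor hconfig
    field
      hstate : HState
      pHead  : Fin (suc m)
      cHead  : Fin (suc n)
      wTape  : Tape

  open HConfig public

  hstep : HConfig → HConfig
  hstep (hconfig q i j W) =
    let (aP , aC , aW , q′) = rule q (lookup P i) (lookup C j) (read W)
    in  hconfig q′ (turn aP i) (turn aC j) (act aW W)

  hrun : HConfig → ℕ → HConfig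
  hrun h zero    = h
  hrun h (suc k) = hstep (hrun h k)

  SameContents : HConfig → HConfig → Set
  SameContents h h′ = ∀ z → cells (wTape h) z ≡ cells (wTape h′) z

  record _≈_ (h h′ : HConfig) : Set where
    field
      same-state    : hstate h ≡ hstate h′
      same-pHead    : pHead h ≡ pHead h′
      same-cHead    : cHead h ≡ cHead h′
      same-contents : SameContents h h′
      same-wHead    : head (wTape h) ≡ head (wTape h′)

  LoopsFrom : HConfig → ℕ → Set
  LoopsFrom h s =
      (∃[ p ] NonZero p × (∀ k → s ≤ k → hrun h (k + p) ≈ hrun h k))
    × (∀ k → s ≤ k → SameContents (hrun h k) (hrun h s))

  At : HState × Fin (suc m) → HConfig → Set
  At (q , i) h = hstate h ≡ q × pHead h ≡ i

  FirstReaches : HState × Fin (suc m) → HConfig → ℕ → Set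
  FirstReaches qi h s = At qi (hrun h s) × (∀ k → k < s → ¬ At qi (hrun h k))

record Coding (M : BinaryTM) : Set where
  field
    {m n}  : ℕ
    P      : Vec Bit (suc m)
    C      : Vec Bit (suc n)
    pHead₀ : Fin (suc m)
    cHead₀ : Fin (suc n)
    ε      : Transducer (Letter ⊤) (Letter ⊤)
    -- The part of a configuration off the work tape ranges over a finite set.
    δ      : HState → Fin (suc m) → Fin (suc n) →
             Transducer (Letter ⊤) (Letter (BinaryTM.State M))
    signal : HState × Fin (suc m)

  open BinaryTM M
  open Hasenjaeger P C public

  initial : Word → HConfig
  initial w = hconfig q₁ pHead₀ cHead₀ (toTape w)

  DecodesTo : HConfig → Config → Set
  DecodesTo (hconfig q i j W) c = ∃[ u ] ∃[ v ]
      Trimmed u × u describes W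
    × Transducer.run (δ q i j) (spell tt u) ≡ just (spell (state c) v)
    × v describes work c

  record SimulatesRun (g : ℕ → ℕ) (c₀ : Config) (h₀ : HConfig) : Set where
    field
      time      : ℕ → ℕ
      time-mono : ∀ i → Is-just (trace c₀ (suc i)) → time i < time (suc i)
      decodes   : ∀ i c → trace c₀ i ≡ just c → DecodesTo (hrun h₀ (time i)) c
      halting   : Halts c₀ ⇔ ∃ (FirstReaches signal h₀)
      loops     : ∀ s → FirstReaches signal h₀ s → LoopsFrom h₀ s
      in-time   : ∀ t → RunsInTime c₀ t →
                  ∃[ s ] s ≤ g t × FirstReaches signal h₀ s

-- Hasenjaeger's machine simulates M in time O(g).
HSimulates_InTimeO_ : BinaryTM → (ℕ → ℕ) → Set
HSimulates M InTimeO g =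
  Σ[ coding ∈ Coding M ] ∃[ K ] (let open Coding coding in
    ∀ c₀ w → state c₀ ≡ q₀ → Trimmed w → w describes work c₀ →
    ∃[ w′ ] Transducer.run ε (spell tt w) ≡ just (spell tt w′)
          × SimulatesRun (λ t → K * g t) c₀ (initial w′))
  where open BinaryTM M

{-# OPTIONS --safe #-}

-- A string 0…01 on P with z zeros acts, started in q₁ with the head of C on its
-- only 0, as one instruction: mark (z = 0), move right (z = 1), move left
-- (z = 2), and for z = 3 + k jump k instructions back, cyclically, if the scanned
-- cell of W is marked.  Hence every program with conditional jumps and a
-- non-erasing tape runs on H with bounded overhead.
--
-- Such a program maintains a queue of bits on W: 01 and 10 are the bits 0 and 1,
-- 00 is free space, and marking both cells of a pair consumes it.  Removing a bit
-- at the front and appending boundedly many at the back costs one walk there and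
-- back, linear in the length of the queue.
--
-- The tape of M is kept in the queue with a marker before the scanned cell.  One
-- pass through the queue performs one step of M and adds a blank at either end.
-- In time t the queue has length O(t), so a pass costs O(t²), and t passes O(t³).
module Submission where

open import Defs
open import Data.Digit using (Bit)
open import Data.Empty using (⊥-elim)
open import Data.Fin as Fin using (Fin; toℕ; fromℕ<; combine; remQuot)
open import Data.Fin.Patterns
open import Data.Fin.Properties using (toℕ-fromℕ<; toℕ-injective; remQuot-combine; any?)
  renaming (_≟_ to _≟ᶠ_)
open import Data.Integer as ℤ using (ℤ; 0ℤ; 1ℤ; -[1+_]) renaming (+_ to ⁺_)
import Data.Integer.Properties as ℤ
open import Algebra.Properties.AbelianGroup ℤ.+-0-abelianGroup using (identityʳ-unique)
open import Data.List using (List; []; _∷_; _++_; _ʳ++_; length; drop; take; reverse; replicate; map; concat; concatMap; tabulate; last)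
open import Data.List.Properties using (drop-drop; length-++; ++-identityʳ; ++-assoc; length-ʳ++; ʳ++-ʳ++; ʳ++-defn;
  length-drop; length-reverse; length-map; map-++; reverse-++; unfold-reverse; reverse-map; concatMap-++; ∷-injectiveˡ; ∷-injectiveʳ)
open import Data.Maybe as Maybe using (Maybe; just; nothing; _>>=_; Is-just)
open import Data.Maybe.Properties using (just-injective)
open import Data.Nat using (ℕ; zero; suc; _+_; _*_; _∸_; _^_; _≤_; _<_; _<?_; z≤n; s≤s)
open import Data.Nat.DivMod using (_mod_; _%_; m%n<n; m%n%n≡m%n; %-distribˡ-+; [m+n]%n≡m%n; m<n⇒m%n≡m)
open import Data.Nat.Induction using (<-rec)
open import Data.Nat.Properties hiding (_≟_)
open import Data.Nat.Solver using (module +-*-Solver)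
open import Data.Product using (_×_; _,_; proj₁; proj₂; map₁; map₂; ∃; ∃-syntax; ∃₂; Σ-syntax)
open import Data.Sum using (inj₁; inj₂)
open import Data.Unit using (⊤; tt)
open import Data.Vec as Vec using (Vec; lookup; fromList)
open import Data.Vec.Properties using (lookup-replicate)
open import Function using (_∘_; _∋_; case_of_)
open import Function.Bundles using (Equivalence; mk⇔)
open import Relation.Binary using (tri<; tri≈; tri>)
open import Relation.Binary.PropositionalEquality
open import Relation.Nullary using (¬_; Dec; yes; no)

-- A bit takes two cells because `W` cannot be erased: from 01 as from 10 one more mark gives 11, so
-- either value can be consumed. Consumed pairs stay on `W` and may come to fill on the order of
-- `t²` cells, but every walk back stops at the last of them. Costs are thus measured by the live
-- queue alone, which keeps the bound cubic.
--
-- Jumps lead only backwards and are taken only on a marked cell. The circularity of `P` makes every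
-- target reachable backwards, and a jump meant to be unconditional is placed where the scanned cell
-- is known to be marked.
--
-- The state of `M` is nowhere on `W`: it is the place on `P` at which a pass begins, and the
-- decoder takes it from there. The signal is cell 0 of `P` in state `q₁`, the start of an
-- instruction that jumps to itself. Since it must not be met earlier, runs are tracked together
-- with the absence of the signal.

-- Words as finite descriptions of tapes

first : List Bit → Bit
first r = nth r 0

nth-drop₁ : ∀ r n → nth (drop 1 r) n ≡ nth r (suc n)
nth-drop₁ []      _ = refl
nth-drop₁ (_ ∷ _) _ = refl

moveʷ : Direction → Word → Word
moveʷ L (word l x r) = word (drop 1 l) (first l) (x ∷ r)
moveʷ R (word l x r) = word (x ∷ l) (first r) (drop 1 r)

writeʷ : Bit → Word → Word
writeʷ y (word l _ r) = word l y r

actʷ : WorkAction → Word → Word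
actʷ L = moveʷ L
actʷ R = moveʷ R
actʷ - = λ w → w
actʷ 𝟙 = writeʷ 1F

layout-moveᴿ : ∀ w z → layout (moveʷ R w) z ≡ layout w (1ℤ ℤ.+ z)
layout-moveᴿ (word _ _ [])      (⁺ zero)      = refl
layout-moveᴿ (word _ _ (_ ∷ _)) (⁺ zero)      = refl
layout-moveᴿ (word _ _ r)       (⁺ suc n)     = nth-drop₁ r n
layout-moveᴿ _                  -[1+ zero ]   = refl
layout-moveᴿ _                  -[1+ suc n ]  = refl

layout-moveᴸ : ∀ w z → layout (moveʷ L w) z ≡ layout w (ℤ.- 1ℤ ℤ.+ z)
layout-moveᴸ (word [] _ _)      (⁺ zero)          = refl
layout-moveᴸ (word (_ ∷ _) _ _) (⁺ zero)          = refl
layout-moveᴸ _                  (⁺ suc zero)      = refl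
layout-moveᴸ _                  (⁺ suc (suc n))   = refl
layout-moveᴸ (word l _ _)       -[1+ n ]          = nth-drop₁ l n

describes-move : ∀ D w T → w describes T → moveʷ D w describes move D T
describes-move L w T d z = trans (cong (cells T) (ℤ.+-assoc (head T) (ℤ.- 1ℤ) z))
  (trans (d (ℤ.- 1ℤ ℤ.+ z)) (sym (layout-moveᴸ w z)))
describes-move R w T d z = trans (cong (cells T) (ℤ.+-assoc (head T) 1ℤ z))
  (trans (d (1ℤ ℤ.+ z)) (sym (layout-moveᴿ w z)))

describes-write : ∀ x w T → w describes T → writeʷ x w describes write x T
describes-write x w (tape f h) d z with (h ℤ.+ z) ℤ.≟ h
describes-write x w (tape f h) d (⁺ zero)  | yes _ = refl
describes-write x w (tape f h) d (⁺ suc n) | yes e with identityʳ-unique h (⁺ suc n) e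
... | ()
describes-write x w (tape f h) d -[1+ n ]  | yes e with identityʳ-unique h -[1+ n ] e
... | ()
describes-write x w (tape f h) d (⁺ zero)  | no ne = ⊥-elim (ne (ℤ.+-identityʳ h))
describes-write x w (tape f h) d (⁺ suc n) | no _ = d (⁺ suc n)
describes-write x w (tape f h) d -[1+ n ]  | no _ = d -[1+ n ]

describes-act : ∀ a w T → w describes T → actʷ a w describes act a T
describes-act L w T d = describes-move L w T d
describes-act R w T d = describes-move R w T d
describes-act - w T d = d
describes-act 𝟙 w T d = describes-write 1F w T d

read-described : ∀ w T → w describes T → read T ≡ Word.under w
read-described w T d = trans (cong (cells T) (sym (ℤ.+-identityʳ (head T)))) (d 0ℤ)

nth-++-blanks : ∀ l k n → nth (l ++ replicate k 0F) n ≡ nth l n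
nth-++-blanks []      zero    n       = refl
nth-++-blanks []      (suc k) zero    = refl
nth-++-blanks []      (suc k) (suc n) = nth-++-blanks [] k n
nth-++-blanks (x ∷ l) k       zero    = refl
nth-++-blanks (x ∷ l) k       (suc n) = nth-++-blanks l k n

-- Words matter only through `layout`, so blanks at the ends are free. This absorbs both the padding
-- of the simulated tape and the free pair that a walk leaves behind the queue.
layout-pad : ∀ j k l x r z → layout (word (l ++ replicate j 0F) x (r ++ replicate k 0F)) z ≡ layout (word l x r) z
layout-pad j k l x r (⁺ zero)  = refl
layout-pad j k l x r (⁺ suc n) = nth-++-blanks r k n
layout-pad j k l x r -[1+ n ]  = nth-++-blanks l j n

-- Head positions on circular tapes

opaque
  at : ∀ {m} → ℕ → Fin (suc m)
  at {m} n = n mod suc m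

  toℕ-at : ∀ {m} n → toℕ (at {m} n) ≡ n % suc m
  toℕ-at {m} n = toℕ-fromℕ< (m%n<n n (suc m))

  turn-R : ∀ {m} (i : Fin (suc m)) → turn R i ≡ at (1 + toℕ i)
  turn-R i = refl

  turn-L : ∀ {m} (i : Fin (suc m)) → turn L i ≡ at (toℕ i + m)
  turn-L i = refl

  at-0 : ∀ {m} → at {m} 0 ≡ 0F
  at-0 = refl

at-cong : ∀ {m} i j → i % suc m ≡ j % suc m → at {m} i ≡ at j
at-cong {m} i j e = toℕ-injective (trans (toℕ-at i) (trans e (sym (toℕ-at j))))

at-toℕ-at : ∀ {m} k n → at {m} (k + toℕ (at {m} n)) ≡ at (k + n)
at-toℕ-at {m} k n = at-cong (k + toℕ (at {m} n)) (k + n) (begin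
  (k + toℕ (at n)) % s        ≡⟨ cong (λ y → (k + y) % s) (toℕ-at n) ⟩
  (k + n % s) % s             ≡⟨ %-distribˡ-+ k (n % s) s ⟩
  (k % s + n % s % s) % s     ≡⟨ cong (λ y → (k % s + y) % s) (m%n%n≡m%n n s) ⟩
  (k % s + n % s) % s         ≡⟨ %-distribˡ-+ k n s ⟨
  (k + n) % s                 ∎)
  where
  open ≡-Reasoning
  s = suc m

-- The last two constructors go around the circle backwards.
data Turn (m : ℕ) : HeadAction → ℕ → ℕ → Set where
  stay   : ∀ {i} → Turn m - i i
  right  : ∀ {i} → Turn m R i (suc i)
  left   : ∀ {i} → Turn m L (suc i) i
  left↺  : ∀ {i} → Turn m L i (m + i)
  right↺ : ∀ {i} → Turn m R (m + i) i

at-cycle : ∀ {m} i → at {m} (m + suc i) ≡ at i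
at-cycle {m} i = at-cong (m + suc i) i
  (trans (cong (_% suc m) (trans (+-suc m i) (+-comm (suc m) i))) ([m+n]%n≡m%n i (suc m)))

turn-L-at : ∀ {m} i → turn {m} L (at i) ≡ at (m + i)
turn-L-at {m} i = trans (turn-L (at i)) (trans (cong at (+-comm (toℕ (at {m} i)) m)) (at-toℕ-at {m} m i))

turn-at : ∀ {m a i j} → Turn m a i j → turn {m} a (at i) ≡ at j
turn-at stay                    = refl
turn-at {m} {i = i} right       = trans (turn-R (at i)) (at-toℕ-at {m} 1 i)
turn-at {m} {i = suc i} left    = trans (turn-L-at (suc i)) (at-cycle i)
turn-at {m} {i = i} left↺       = turn-L-at i
turn-at {m} {j = i} right↺      = trans (turn-R (at (m + i)))
  (trans (at-toℕ-at {m} 1 (m + i)) (trans (cong at (sym (+-suc m i))) (at-cycle i)))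

-- Runs without the signal, and periodic runs

module Runs {m n} (P : Vec Bit (suc m)) (C : Vec Bit (suc n)) where

  open Hasenjaeger P C public

  -- A configuration with a word for its work tape and with the positions of
  -- the circular heads given up to a multiple of the length of the tape.
  record Situation : Set where
    constructor sit
    field
      stateˢ      : HState
      pˢ cˢ       : ℕ
      wordˢ       : Word

  record _~_ (h : HConfig) (x : Situation) : Set where
    constructor agree
    open Situation x
    field
      same-state : hstate h ≡ stateˢ
      same-p     : pHead h ≡ at pˢ
      same-c     : cHead h ≡ at cˢ
      described  : wordˢ describes wTape h

  -- The new positions are indices and not computed from the old ones: a circular position has many
  -- representatives, and each use picks the convenient one.
  data _↦_ : Situation → Situation → Set where
    fire : ∀ {q i j w b d s aP aC aW q′ i′ j′} →
           lookup P (at i) ≡ b → lookup C (at j) ≡ d → Word.under w ≡ s →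
           rule q b d s ≡ (aP , aC , aW , q′) → Turn m aP i i′ → Turn n aC j j′ →
           sit q i j w ↦ sit q′ i′ j′ (actʷ aW w)

  ~-step : ∀ {h x y} → x ↦ y → h ~ x → hstep h ~ y
  ~-step {hconfig q _ _ T} (fire {w = w} {aW = aW} refl refl refl e tP tC) (agree refl refl refl d)
    rewrite read-described w T d | e =
    agree refl (turn-at tP) (turn-at tC) (describes-act aW w T d)

  -- Cell 0 of `P` is to hold the start of the self-jump in which a halted simulation ends.
  signalled : HState × Fin (suc m)
  signalled = q₁ , 0F

  -- Demanded at the source of each step and not at its target, so that a quiet run may still end on
  -- the signal.
  Quiet : Situation → Set
  Quiet (sit q i _ _) = q ≡ q₁ → at i ≢ (Fin (suc m) ∋ 0F)

  data Steps : ℕ → Situation → Situation → Set where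
    done : ∀ {x} → Steps 0 x x
    tick : ∀ {k x y z} → Quiet x → x ↦ y → Steps k y z → Steps (suc k) x z

  infixr 5 _⊕_

  _⊕_ : ∀ {j k x y z} → Steps j x y → Steps k y z → Steps (j + k) x z
  done         ⊕ s′ = s′
  tick q e s   ⊕ s′ = tick q e (s ⊕ s′)

  hrun-hstep : ∀ h k → hrun h (suc k) ≡ hrun (hstep h) k
  hrun-hstep h zero    = refl
  hrun-hstep h (suc k) = cong hstep (hrun-hstep h k)

  hrun-+ : ∀ h j k → hrun h (j + k) ≡ hrun (hrun h j) k
  hrun-+ h zero    k = refl
  hrun-+ h (suc j) k = begin
    hrun h (suc (j + k))         ≡⟨ hrun-hstep h (j + k) ⟩
    hrun (hstep h) (j + k)       ≡⟨ hrun-+ (hstep h) j k ⟩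
    hrun (hrun (hstep h) j) k    ≡⟨ cong (λ h′ → hrun h′ k) (hrun-hstep h j) ⟨
    hrun (hrun h (suc j)) k      ∎
    where open ≡-Reasoning

  QuietBefore : ℕ → HConfig → Set
  QuietBefore k h = ∀ j → j < k → ¬ At signalled (hrun h j)

  QuietBefore-+ : ∀ j k {h} → QuietBefore j h → QuietBefore k (hrun h j) → QuietBefore (j + k) h
  QuietBefore-+ j k {h} q q′ i i<j+k hit with i <? j
  ... | yes i<j = q i i<j hit
  ... | no  i≮j = q′ (i ∸ j) (+-cancelˡ-< j _ _ (subst (_< j + k) (sym eq) i<j+k))
                    (subst (At signalled) (trans (cong (hrun h) (sym eq)) (hrun-+ h j (i ∸ j))) hit)
    where eq = m+[n∸m]≡n (≮⇒≥ i≮j)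

  FirstReaches-unique : ∀ {h s s′} → FirstReaches signalled h s → FirstReaches signalled h s′ → s ≡ s′
  FirstReaches-unique {s = s} {s′} (a , q) (a′ , q′) with <-cmp s s′
  ... | tri< s<s′ _ _ = ⊥-elim (q′ s s<s′ a)
  ... | tri≈ _ e _    = e
  ... | tri> _ _ s′<s = ⊥-elim (q s′ s′<s a′)

  follow : ∀ {k x y h} → Steps k x y → h ~ x → hrun h k ~ y × QuietBefore k h
  follow done h~x = h~x , λ _ ()
  follow {suc k} {x} {h = h} (tick quiet x↦y s) h~x
    with follow s (~-step x↦y h~x)
  ... | end , silent = subst (_~ _) (sym (hrun-hstep h k)) end , silent′
    where
    open _~_ h~x
    silent′ : QuietBefore (suc k) h
    silent′ zero    _         (e₁ , e₂) = quiet (trans (sym same-state) e₁) (trans (sym same-p) e₂)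
    silent′ (suc j) (s≤s j<k) hit       = silent j j<k (subst (At signalled) (hrun-hstep h j) hit)

  -- Empty runs are excluded: that `time` increases strictly, and that it is at least the number of
  -- steps of `M`, both rest on this.
  record Reach (k : ℕ) (x y : Situation) : Set where
    constructor reach
    field
      {steps}  : ℕ
      path     : Steps (suc steps) x y
      bound    : suc steps ≤ k

  infixr 5 _⊛_

  _⊛_ : ∀ {j k x y z} → Reach j x y → Reach k y z → Reach (j + k) x z
  reach s b ⊛ reach s′ b′ = reach (s ⊕ s′) (+-mono-≤ b b′)

  weaken : ∀ {j k x y} → j ≤ k → Reach j x y → Reach k x y
  weaken j≤k (reach s b) = reach s (≤-trans b j≤k)

  Spot : Set
  Spot = HState × ℕ × ℕ

  standing : Tape → Spot → HConfig
  standing T (q , i , j) = hconfig q (at i) (at j) T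

  -- Here the tape itself is kept, in place of a word describing it, because `LoopsFrom` compares
  -- contents and head position exactly.
  data Stays (T : Tape) : ℕ → Spot → Spot → Set where
    stop : ∀ {x} → Stays T 0 x x
    stay : ∀ {k q i j b d s aP aC q′ i′ j′ y} →
      lookup P (at i) ≡ b → lookup C (at j) ≡ d → read T ≡ s →
      rule q b d s ≡ (aP , aC , - , q′) → Turn m aP i i′ → Turn n aC j j′ →
      Stays T k (q′ , i′ , j′) y → Stays T (suc k) (q , i , j) y

  stays : ∀ {T k x y} → Stays T k x y →
          hrun (standing T x) k ≡ standing T y × (∀ j → j < k → wTape (hrun (standing T x) j) ≡ T)
  stays stop = refl , λ _ ()
  stays {T} {suc k} {x} (stay {q′ = q′} {i′} {j′} refl refl refl e tP tC s) with stays s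
  ... | end , tapes = trans (hrun-hstep h k) (trans (cong (λ h → hrun h k) first-step) end) , tapes′
    where
    h = standing T x
    first-step : hstep h ≡ standing T (q′ , i′ , j′)
    first-step rewrite e | turn-at tP | turn-at tC = refl
    tapes′ : ∀ j → j < suc k → wTape (hrun h j) ≡ T
    tapes′ zero    _         = refl
    tapes′ (suc j) (s≤s j<k) = trans (cong wTape (trans (hrun-hstep h j) (cong (λ h → hrun h j) first-step))) (tapes j j<k)

  module Circuit {T k x} (circuit : Stays T (suc k) x x) where

    private
      p = suc k
      h = standing T x

    returns : ∀ j → hrun h (j + p) ≡ hrun h j
    returns j = begin
      hrun h (j + p)          ≡⟨ cong (hrun h) (+-comm j p) ⟩
      hrun h (p + j)          ≡⟨ hrun-+ h p j ⟩
      hrun (hrun h p) j       ≡⟨ cong (λ h → hrun h j) (proj₁ (stays circuit)) ⟩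
      hrun h j                ∎
      where open ≡-Reasoning

    steady : ∀ j → wTape (hrun h j) ≡ T
    -- Whole periods are removed until `j` falls inside the first circuit.
    steady = <-rec _ λ j ih → case j <? p of λ where
      (yes j<p) → proj₂ (stays circuit) _ j<p
      (no  j≮p) → trans (cong wTape (trans (cong (hrun h) (sym (m∸n+n≡m (≮⇒≥ j≮p)))) (returns (j ∸ p))))
                    (ih (∸-monoʳ-< (s≤s z≤n) (≮⇒≥ j≮p)))

    loops-forever : ∀ {h₀ s} → hrun h₀ s ≡ h → LoopsFrom h₀ s
    loops-forever {h₀} {s} e = (p , _ , λ j s≤j → ≡⇒≈ (begin
        hrun h₀ (j + p)         ≡⟨ shift (≤-trans s≤j (m≤m+n j p)) ⟩
        hrun h (j + p ∸ s)      ≡⟨ cong (hrun h) (+-∸-comm p s≤j) ⟩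
        hrun h (j ∸ s + p)      ≡⟨ returns (j ∸ s) ⟩
        hrun h (j ∸ s)          ≡⟨ shift s≤j ⟨
        hrun h₀ j               ∎))
      , λ j s≤j z → cong (λ T → cells T z) (trans (cong wTape (shift s≤j)) (trans (steady (j ∸ s)) (cong wTape (sym e))))
      where
      open ≡-Reasoning
      shift : ∀ {j} → s ≤ j → hrun h₀ j ≡ hrun h (j ∸ s)
      shift {j} s≤j = trans (cong (hrun h₀) (sym (m+[n∸m]≡n s≤j)))
        (trans (hrun-+ h₀ s (j ∸ s)) (cong (λ h → hrun h (j ∸ s)) e))
      ≡⇒≈ : ∀ {h h′} → h ≡ h′ → h ≈ h′
      ≡⇒≈ refl = record { same-state = refl; same-pHead = refl; same-cHead = refl; same-contents = λ _ → refl; same-wHead = refl }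

-- Instructions in unary

zeros : ℕ → List Bit → List Bit
zeros zero    r = 1F ∷ r
zeros (suc z) r = 0F ∷ zeros z r

bits : List ℕ → List Bit
bits []       = []
bits (z ∷ zs) = zeros z (bits zs)

weight : List ℕ → ℕ
weight []       = 0
weight (z ∷ zs) = suc (z + weight zs)

zeros-++ : ∀ z r r′ → zeros z r ++ r′ ≡ zeros z (r ++ r′)
zeros-++ zero    r r′ = refl
zeros-++ (suc z) r r′ = cong (0F ∷_) (zeros-++ z r r′)

bits-++ : ∀ xs ys → bits (xs ++ ys) ≡ bits xs ++ bits ys
bits-++ []       ys = refl
bits-++ (x ∷ xs) ys = trans (cong (zeros x) (bits-++ xs ys)) (sym (zeros-++ x (bits xs) (bits ys)))

length-zeros : ∀ z r → length (zeros z r) ≡ suc (z + length r)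
length-zeros zero    r = refl
length-zeros (suc z) r = cong suc (length-zeros z r)

length-bits : ∀ zs → length (bits zs) ≡ weight zs
length-bits []       = refl
length-bits (z ∷ zs) = trans (length-zeros z (bits zs)) (cong (λ k → suc (z + k)) (length-bits zs))

weight-ʳ++ : ∀ rx ys → weight (rx ʳ++ ys) ≡ weight rx + weight ys
weight-ʳ++ []       ys = refl
weight-ʳ++ (z ∷ rx) ys = begin
  weight (rx ʳ++ z ∷ ys)               ≡⟨ weight-ʳ++ rx (z ∷ ys) ⟩
  weight rx + (suc z + weight ys)      ≡⟨ +-assoc (weight rx) (suc z) (weight ys) ⟨
  weight rx + suc z + weight ys        ≡⟨ cong (_+ weight ys) (+-comm (weight rx) (suc z)) ⟩
  suc z + weight rx + weight ys        ∎
  where open ≡-Reasoning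

drop-zeros : ∀ z r → drop (suc z) (zeros z r) ≡ r
drop-zeros zero    r = refl
drop-zeros (suc z) r = drop-zeros z r

drop-bits : ∀ rx ys → drop (weight rx) (bits (rx ʳ++ ys)) ≡ bits ys
drop-bits []       ys = refl
drop-bits (z ∷ rx) ys = begin
  drop (suc z + weight rx) bs          ≡⟨ cong (λ k → drop k bs) (+-comm (suc z) (weight rx)) ⟩
  drop (weight rx + suc z) bs          ≡⟨ drop-drop (weight rx) (suc z) bs ⟨
  drop (suc z) (drop (weight rx) bs)   ≡⟨ cong (drop (suc z)) (drop-bits rx (z ∷ ys)) ⟩
  drop (suc z) (zeros z (bits ys))     ≡⟨ drop-zeros z (bits ys) ⟩
  bits ys                              ∎
  where
  open ≡-Reasoning
  bs = bits (rx ʳ++ z ∷ ys)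

drop-suc : ∀ {A : Set} n (xs : List A) {b r} → drop n xs ≡ b ∷ r → drop (suc n) xs ≡ r
drop-suc zero    (x ∷ xs) refl = refl
drop-suc (suc n) (x ∷ xs) e    = drop-suc n xs e

drop-∷⇒< : ∀ {A : Set} n (xs : List A) {b r} → drop n xs ≡ b ∷ r → n < length xs
drop-∷⇒< zero    (x ∷ xs) e = s≤s z≤n
drop-∷⇒< (suc n) (x ∷ xs) e = s≤s (drop-∷⇒< n xs e)

drop-length-+ : ∀ {A : Set} (xs ys : List A) n → drop (length xs + n) (xs ++ ys) ≡ drop n ys
drop-length-+ []       ys n = refl
drop-length-+ (x ∷ xs) ys n = drop-length-+ xs ys n

lookup-drop : ∀ {A : Set} (xs ys : List A) {b r} (i : Fin (length xs)) →
              drop (toℕ i) (xs ++ ys) ≡ b ∷ r → lookup (fromList xs) i ≡ b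
lookup-drop (x ∷ xs) ys Fin.zero    refl = refl
lookup-drop (x ∷ xs) ys (Fin.suc i) e    = lookup-drop xs ys i e

module Circular {A : Set} (x : A) (xs : List A) where

  private
    cycle = x ∷ xs

  lookup-first : ∀ n ys {b r} → n < length cycle → drop n (cycle ++ ys) ≡ b ∷ r →
                 lookup (fromList cycle) (at n) ≡ b
  lookup-first n ys n<l e = lookup-drop cycle ys (at n)
    (trans (cong (λ k → drop k (cycle ++ ys)) (trans (toℕ-at n) (m<n⇒m%n≡m n<l))) e)

  lookup-twice : ∀ n {b r} → drop n (cycle ++ cycle) ≡ b ∷ r → lookup (fromList cycle) (at n) ≡ b
  lookup-twice n e with n <? length cycle
  ... | yes n<l = lookup-first n cycle n<l e
  ... | no  n≮l = subst (λ i → lookup (fromList cycle) i ≡ _) wrap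
                    (lookup-first n′ [] (drop-∷⇒< n′ cycle e′) (trans (cong (drop n′) (++-identityʳ cycle)) e′))
    where
    n′ = n ∸ length cycle
    n≡ : length cycle + n′ ≡ n
    n≡ = m+[n∸m]≡n (≮⇒≥ n≮l)
    e′ : drop n′ cycle ≡ _
    e′ = trans (sym (drop-length-+ cycle cycle n′)) (trans (cong (λ k → drop k (cycle ++ cycle)) n≡) e)
    wrap : at n′ ≡ at n
    wrap = at-cong n′ n (trans (sym ([m+n]%n≡m%n n′ (length cycle)))
             (cong (_% length cycle) (trans (+-comm n′ (length cycle)) n≡)))

-- Execution of single instructions

module Program (rest : List ℕ) where

  program : List ℕ
  program = 3 ∷ rest

  -- Executing in the second of two copies of the circular program, no
  -- backward jump runs off the left end.
  twice : List ℕ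
  twice = program ++ program

  opaque
    -- A jump moves the head of `C` at most `size` cells away from the 0, so the count never wraps
    -- around. `κ` covers the longest instruction, a jump: at most `size` cells forward, at most
    -- `size` back, and a constant for the turning points.
    lastCell size κ : ℕ
    lastCell = length (0F ∷ 0F ∷ 1F ∷ bits rest)
    size     = weight twice
    κ        = 5 + (size + size)

    P : Vec Bit (suc lastCell)
    P = fromList (bits program)

    C : Vec Bit (suc size)
    C = 0F Vec.∷ Vec.replicate size 1F

    κ-≥ : 5 + (size + size) ≤ κ
    κ-≥ = ≤-refl

    weight-program : weight program ≡ suc lastCell
    weight-program = sym (length-bits program)

    weight-twice : weight twice ≡ size
    weight-twice = refl

    P-0 : lookup P 0F ≡ 0F
    P-0 = refl

    P-lookup : ∀ n {b r} → drop n (bits program ++ bits program) ≡ b ∷ r → lookup P (at n) ≡ b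
    P-lookup = Circular.lookup-twice 0F (0F ∷ 0F ∷ 1F ∷ bits rest)

    C-0 : lookup C 0F ≡ 0F
    C-0 = refl

    C-suc : ∀ i → lookup C (Fin.suc i) ≡ 1F
    C-suc i = lookup-replicate i 1F

  open Runs P C public

  record Code (n : ℕ) (r : List Bit) : Set where
    constructor code
    field coded : drop n (bits twice) ≡ r

  Code-lookup : ∀ {n b r} → Code n (b ∷ r) → lookup P (at n) ≡ b
  Code-lookup {n} (code e) = P-lookup n (trans (cong (drop n) (sym (bits-++ program program))) e)

  Code-suc : ∀ {n b r} → Code n (b ∷ r) → Code (suc n) r
  Code-suc {n} (code e) = code (drop-suc n (bits twice) e)

  Code-0 : ∀ z {n r j} → Code n (zeros z r) → j < z → lookup P (at (j + n)) ≡ 0F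
  Code-0 (suc z) {j = zero}  e _         = Code-lookup e
  Code-0 (suc z) {n} {j = suc j} e (s≤s j<z) =
    subst (λ k → lookup P (at k) ≡ 0F) (+-suc j n) (Code-0 z (Code-suc e) j<z)

  Code-1 : ∀ z {n r} → Code n (zeros z r) → lookup P (at (z + n)) ≡ 1F
  Code-1 zero    e = Code-lookup e
  Code-1 (suc z) {n} e = subst (λ k → lookup P (at k) ≡ 1F) (+-suc z n) (Code-1 z (Code-suc e))

  C-home : lookup C (at 0) ≡ 0F
  C-home = trans (cong (lookup C) at-0) C-0

  C-away : ∀ c → c < size → lookup C (at (suc c)) ≡ 1F
  C-away c c<size = trans (cong (lookup C) (toℕ-injective {i = at (suc c)} {j = Fin.suc (fromℕ< c<size)}
    (trans (toℕ-at (suc c)) (trans (m<n⇒m%n≡m (s≤s c<size)) (cong suc (sym (toℕ-fromℕ< c<size)))))))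
    (C-suc (fromℕ< c<size))

  -- A zipper: `rx` lists the instructions already passed, nearest first, so that jumping back by
  -- `k` is `drop k rx` and the position on `P` is `weight rx`.
  record Split (rx ys : List ℕ) : Set where
    constructor split
    field splits : twice ≡ rx ʳ++ ys

  split-next : ∀ {rx z ys} → Split rx (z ∷ ys) → Split (z ∷ rx) ys
  split-next (split e) = split e

  split-back : ∀ {rx z ys} → Split (z ∷ rx) ys → Split rx (z ∷ ys)
  split-back (split e) = split e

  split-code : ∀ {rx ys} → Split rx ys → Code (weight rx) (bits ys)
  split-code {rx} {ys} (split e) = code (trans (cong (λ xs → drop (weight rx) (bits xs)) e) (drop-bits rx ys))

  split-size : ∀ {rx ys} → Split rx ys → weight rx ≤ size
  split-size {rx} {ys} (split e) = subst (weight rx ≤_) (trans (sym (weight-ʳ++ rx ys)) (trans (cong weight (sym e)) weight-twice)) (m≤m+n _ _)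

  here : List ℕ → Word → Situation
  here rx w = sit q₁ (weight rx) 0 w

  Awake : List ℕ → Set
  Awake rx = at {lastCell} (weight rx) ≢ 0F

  private
    quiet : ∀ {q p c w} → q ≢ q₁ → Quiet (sit q p c w)
    quiet q≢ e = ⊥-elim (q≢ e)

  1≢0 : _≢_ {A = Bit} 1F 0F
  1≢0 ()

  exec-mark : ∀ {rx ys w} → Split rx (0 ∷ ys) → Awake rx →
              Reach κ (here rx w) (here (0 ∷ rx) (writeʷ 1F w))
  exec-mark {w = word l 0F r} e aw = reach (tick (λ _ → aw) (fire (Code-lookup (split-code e)) refl refl refl right stay) done) (≤-trans (s≤s z≤n) κ-≥)
  exec-mark {w = word l 1F r} e aw = reach (tick (λ _ → aw) (fire (Code-lookup (split-code e)) refl refl refl right stay) done) (≤-trans (s≤s z≤n) κ-≥)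

  exec-right : ∀ {rx ys w} → Split rx (1 ∷ ys) → Awake rx →
               Reach κ (here rx w) (here (1 ∷ rx) (moveʷ R w))
  exec-right e aw = reach
    (tick (λ _ → aw) (fire (Code-lookup c₀) refl refl refl right stay)
    (tick (λ ()) (fire (Code-lookup (Code-suc c₀)) C-home refl refl right stay) done)) (≤-trans (s≤s (s≤s z≤n)) κ-≥)
    where c₀ = split-code e

  <-size : ∀ {rx z ys c} → Split rx (z ∷ ys) → c ≤ z → c < size
  <-size {rx} {z} e c≤z = ≤-trans (s≤s (≤-trans c≤z (m≤m+n z (weight rx)))) (split-size (split-next e))

  exec-left : ∀ {rx ys w} → Split rx (2 ∷ ys) → Awake rx →
              Reach κ (here rx w) (here (2 ∷ rx) (moveʷ L w))
  exec-left e aw = reach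
    (tick (λ _ → aw) (fire (Code-lookup c₀) refl refl refl right stay)
    (tick (λ ()) (fire (Code-lookup (Code-suc c₀)) C-home refl refl right right)
    (tick (λ ()) (fire (Code-lookup (Code-suc (Code-suc c₀))) (C-away 0 (<-size e z≤n)) refl refl right left) done)))
    (≤-trans (s≤s (s≤s (s≤s z≤n))) κ-≥)
    where c₀ = split-code e

  enter-jump : ∀ {rx ys k w} → Split rx (3 + k ∷ ys) → Awake rx →
               Steps 3 (here rx w) (sit q₃ (3 + weight rx) 0 w)
  enter-jump e aw =
    tick (λ _ → aw) (fire (Code-lookup c₀) refl refl refl right stay)
    (tick (λ ()) (fire (Code-lookup (Code-suc c₀)) C-home refl refl right right)
    (tick (λ ()) (fire (Code-lookup (Code-suc (Code-suc c₀))) (C-away 0 (<-size e z≤n)) refl refl right left) done))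
    where c₀ = split-code e

  skip-zeros : ∀ k {n r w} → Code n (zeros k r) → Word.under w ≡ 0F →
         Steps (suc k) (sit q₃ n 0 w) (sit q₁ (suc (k + n)) 0 w)
  skip-zeros zero    e u = tick (λ ()) (fire (Code-lookup e) refl u refl right stay) done
  skip-zeros (suc k) {n} {w = w} e u = tick (λ ()) (fire (Code-lookup e) refl u refl right stay)
    (subst (λ j → Steps (suc k) (sit q₃ (suc n) 0 w) (sit q₁ (suc j) 0 w)) (+-suc k n) (skip-zeros k (Code-suc e) u))

  exec-pass : ∀ k {rx ys w} → Split rx (3 + k ∷ ys) → Awake rx → Word.under w ≡ 0F →
              Reach κ (here rx w) (here (3 + k ∷ rx) w)
  exec-pass k {rx} {ys} {w} e aw u = reach
    (enter-jump e aw ⊕ subst (λ j → Steps (suc k) (sit q₃ (3 + weight rx) 0 w) (sit q₁ j 0 w))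
       (cong suc k+3) (skip-zeros k (Code-suc (Code-suc (Code-suc (split-code e)))) u))
    (≤-trans (+-mono-≤ {3} {5} (s≤s (s≤s (s≤s z≤n))) (≤-trans (<-size e (m≤n+m k 3)) (m≤m+n size size))) κ-≥)
    where
    k+3 : k + (3 + weight rx) ≡ 3 + k + weight rx
    k+3 = trans (sym (+-assoc k 3 (weight rx))) (cong (_+ weight rx) (+-comm k 3))

  -- The head of `C` takes down the unary distance, one cell per zero, plus one cell at the closing
  -- 1. The extra cell pays for the 1 directly in front of the jump, which has to be crossed even
  -- for `k = 0`.
  count-zeros : ∀ k {n c r w} → Code (suc n) (zeros k r) → Word.under w ≡ 1F →
          Steps (suc k) (sit q₃ (suc n) c w) (sit q₄ (k + n) (suc (k + c)) w)
  count-zeros zero    e u = tick (λ ()) (fire (Code-lookup e) refl u refl left right) done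
  count-zeros (suc k) {n} {c} {w = w} e u = tick (λ ()) (fire (Code-lookup e) refl u refl right right)
    (subst₂ (λ i j → Steps (suc k) (sit q₃ (suc (suc n)) (suc c) w) (sit q₄ i (suc j) w))
      (+-suc k n) (+-suc k c) (count-zeros k (Code-suc e) u))

  over-zeros : ∀ k {p c w} → (∀ j → j < k → lookup P (at (j + suc p)) ≡ 0F) → c < size →
               Steps k (sit q₄ (k + p) (suc c) w) (sit q₄ p (suc c) w)
  over-zeros zero    zs c<s = done
  over-zeros (suc k) {p} zs c<s =
    tick (λ ()) (fire (subst (λ i → lookup P (at i) ≡ 0F) (+-suc k p) (zs k ≤-refl)) (C-away _ c<s) refl refl left stay)
      (over-zeros k (λ j j<k → zs j (m≤n⇒m≤1+n j<k)) c<s)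

  -- The jump ends on the 1 preceding its target, read in q₁: a mark on a cell that
  -- is marked already.
  back-up : ∀ c z rx {ys w} → Split (z ∷ rx) ys → c ≤ length rx → c < size → Word.under w ≡ 1F →
         ∃[ k ] Steps (suc k) (sit q₄ (z + weight rx) (suc c) w) (here (drop c (z ∷ rx)) w)
              × suc k ≤ 3 + (z + weight rx)
  back-up zero z rx {ys} {w} e _ c<s u = 2 ,
      tick (λ ()) (fire one (C-away 0 c<s) refl refl left↺ left)
      (tick (λ ()) (land _ refl)
      -- Cell 0 of `P` carries a 0, so a 1 read in `q₁` is never the signal.
      (tick (λ _ p≡0 → 1≢0 (trans (sym one) (trans (cong (lookup P) p≡0) P-0))) (fire one refl u refl right stay) done))
    , s≤s (s≤s (s≤s z≤n))
    where
    one : lookup P (at (z + weight rx)) ≡ 1F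
    one = Code-1 z (split-code (split-back e))
    -- In `q₄` with `C` on its 0 both symbols on `P` have the same effect, but `rule` reduces only
    -- once the symbol is known.
    land : ∀ b → lookup P (at (lastCell + (z + weight rx))) ≡ b →
           sit q₄ (lastCell + (z + weight rx)) 0 w ↦ sit q₁ (z + weight rx) 0 w
    land 0F e′ = fire e′ C-home refl refl right↺ stay
    land 1F e′ = fire e′ C-home refl refl right↺ stay
  back-up (suc c) z (z′ ∷ rx) {ys} {w} e (s≤s c≤) c<s u
    with back-up c z′ rx (split-back e) c≤ (<-trans (n<1+n c) c<s) u
  ... | k , s , b = _ ,
      tick (λ ()) (fire one (C-away (suc c) c<s) refl refl (subst (λ i → Turn lastCell L i (z + p)) (sym (+-suc z p)) left) left)
        (over-zeros z (λ j → Code-0 z c₀) (<-trans (n<1+n c) c<s) ⊕ s)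
    , (begin
        suc (z + suc k)      ≤⟨ s≤s (+-monoʳ-≤ z b) ⟩
        suc (z + (3 + p))    ≡⟨ cong suc (+-suc z (2 + p)) ⟩
        2 + (z + (2 + p))    ≡⟨ cong (2 +_) (+-suc z (1 + p)) ⟩
        3 + (z + suc p)      ∎)
    where
    open ≤-Reasoning
    p = z′ + weight rx
    c₀ : Code (suc p) (zeros z (bits ys))
    c₀ = split-code (split-back e)
    one : lookup P (at (z + suc p)) ≡ 1F
    one = Code-1 z c₀

  exec-jump : ∀ k {rx ys w} → Split rx (3 + k ∷ ys) → Awake rx → k < length rx → Word.under w ≡ 1F →
              Reach κ (here rx w) (here (drop k rx) w)
  exec-jump k {z ∷ rx} {ys} {w} e aw (s≤s k≤) u
    with back-up k z rx e k≤ (<-size e (m≤n+m k 3)) u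
  ... | j , s , b = reach
      (enter-jump e aw ⊕ (subst₂ (λ i c → Steps (suc k) (sit q₃ (4 + p) 0 w) (sit q₄ i (suc c) w))
          top (+-identityʳ k) (count-zeros k (Code-suc (Code-suc (Code-suc c₀))) u))
        ⊕ over-zeros (3 + k) (λ _ → Code-0 (3 + k) c₀) (<-size e (m≤n+m k 3))
        ⊕ s)
      (begin
        3 + (suc k + (3 + k + suc j))          ≤⟨ +-monoʳ-≤ (4 + k) (+-monoʳ-≤ (3 + k) b) ⟩
        4 + k + (3 + k + (3 + p))              ≤⟨ +-mono-≤ {4 + k} {size} (<-size e ≤-refl) lem ⟩
        size + (5 + (4 + k + p))               ≤⟨ +-monoʳ-≤ size (+-monoʳ-≤ 5 (≤-trans (+-monoʳ-≤ (4 + k) (n≤1+n p)) (split-size (split-next e)))) ⟩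
        size + (5 + size)                      ≡⟨ +-comm size (5 + size) ⟩
        5 + (size + size)                      ≤⟨ κ-≥ ⟩
        κ                                      ∎)
    where
    open ≤-Reasoning
    p = z + weight rx
    c₀ : Code (suc p) (zeros (3 + k) (bits ys))
    c₀ = split-code e
    top : k + (3 + p) ≡ 3 + k + p
    top = trans (sym (+-assoc k 3 p)) (cong (_+ p) (+-comm k 3))
    lem : 3 + k + (3 + p) ≤ 5 + (4 + k + p)
    lem = ≤-trans (≤-reflexive (cong (3 +_) top)) (m≤n+m _ 3)

  -- A jump by 0: four cells `0001` read forward, three zeros and the preceding 1 read backward,
  -- then one step back to the right and the idle mark on that 1, ten steps in all.
  halt-circuit : ∀ {z rx ys T} → Split (z ∷ rx) (3 ∷ ys) → read T ≡ 1F →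
    Stays T 10 (q₁ , weight (z ∷ rx) , 0) (q₁ , weight (z ∷ rx) , 0)
  halt-circuit {z} {rx} {T = T} e r =
    stay b₁ C-home r refl right stay
    (stay b₂ C-home r refl right right
    (stay b₃ C-1 r refl right left
    (stay b₄ C-home r refl left right
    (stay b₃ C-1 r refl left stay
    (stay b₂ C-1 r refl left stay
    (stay b₁ C-1 r refl left stay
    (stay b₀ C-1 r refl left↺ left
    (land _ refl
    (stay b₀ C-home r refl right stay stop)))))))))
    where
    c₁  = split-code e
    b₁  = Code-lookup c₁
    b₂  = Code-lookup (Code-suc c₁)
    b₃  = Code-lookup (Code-suc (Code-suc c₁))
    b₄  = Code-lookup (Code-suc (Code-suc (Code-suc c₁)))
    b₀  = Code-1 z (split-code (split-back e))
    C-1 = C-away 0 (<-size e z≤n)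
    land : ∀ {k y} b → lookup P (at (lastCell + (z + weight rx))) ≡ b →
           Stays T k (q₁ , z + weight rx , 0) y → Stays T (suc k) (q₄ , lastCell + (z + weight rx) , 0) y
    land 0F e′ = stay e′ C-home r refl right↺ stay
    land 1F e′ = stay e′ C-home r refl right↺ stay

-- Programs with labels

module _ {A : Set} where

  offset : ∀ {n} → (Fin n → List A) → Fin n → ℕ
  offset g Fin.zero    = 0
  offset g (Fin.suc i) = length (g Fin.zero) + offset (g ∘ Fin.suc) i

  concat-tabulate-split : ∀ {n} (g : Fin n → List A) i →
    ∃₂ λ xs ys → concat (tabulate g) ≡ xs ++ g i ++ ys × length xs ≡ offset g i
  concat-tabulate-split g Fin.zero    = [] , _ , refl , refl
  concat-tabulate-split g (Fin.suc i) with concat-tabulate-split (g ∘ Fin.suc) i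
  ... | xs , ys , e , l = g Fin.zero ++ xs , ys
      , trans (cong (g Fin.zero ++_) e) (sym (++-assoc (g Fin.zero) xs _))
      , trans (length-++ (g Fin.zero)) (cong (length (g Fin.zero) +_) l)

  offset-injective : ∀ {n} (g : Fin n → List A) → (∀ i → 0 < length (g i)) →
                     ∀ {i j} → offset g i ≡ offset g j → i ≡ j
  offset-injective g pos {Fin.zero}  {Fin.zero}  e = refl
  offset-injective g pos {Fin.zero}  {Fin.suc j} e = ⊥-elim (<⇒≢ (≤-trans (pos Fin.zero) (m≤m+n _ _)) e)
  offset-injective g pos {Fin.suc i} {Fin.zero}  e = ⊥-elim (<⇒≢ (≤-trans (pos Fin.zero) (m≤m+n _ _)) (sym e))
  offset-injective g pos {Fin.suc i} {Fin.suc j} e =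
    cong Fin.suc (offset-injective (g ∘ Fin.suc) (pos ∘ Fin.suc) (+-cancelˡ-≡ (length (g Fin.zero)) _ _ e))

  take-++-≤ : ∀ k (xs ys : List A) → k ≤ length xs → take k (xs ++ ys) ≡ take k xs
  take-++-≤ zero    xs       ys _        = refl
  take-++-≤ (suc k) (x ∷ xs) ys (s≤s k≤) = cong (x ∷_) (take-++-≤ k xs ys k≤)

  take-length-++ : ∀ (xs ys : List A) k → take (length xs + k) (xs ++ ys) ≡ xs ++ take k ys
  take-length-++ []       ys k = refl
  take-length-++ (x ∷ xs) ys k = cong (x ∷_) (take-length-++ xs ys k)

  ʳ++-∷ : ∀ (xs : List A) y ys → ∃₂ λ z zs → xs ʳ++ y ∷ ys ≡ z ∷ zs
  ʳ++-∷ []       y ys = y , ys , refl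
  ʳ++-∷ (x ∷ xs) y ys = ʳ++-∷ xs x (y ∷ ys)

weight-++ : ∀ xs ys → weight (xs ++ ys) ≡ weight xs + weight ys
weight-++ []       ys = refl
weight-++ (x ∷ xs) ys = cong suc (trans (cong (x +_) (weight-++ xs ys)) (sym (+-assoc x (weight xs) (weight ys))))

weight-take-< : ∀ k xs → k < length xs → weight (take k xs) < weight xs
weight-take-< zero    (x ∷ xs) _        = s≤s z≤n
weight-take-< (suc k) (x ∷ xs) (s≤s k<) = s≤s (+-monoʳ-< x (weight-take-< k xs k<))

weight-take-injective : ∀ i j xs → i ≤ length xs → j ≤ length xs → weight (take i xs) ≡ weight (take j xs) → i ≡ j
weight-take-injective zero    zero    xs       _        _        _ = refl
weight-take-injective (suc i) (suc j) (x ∷ xs) (s≤s i≤) (s≤s j≤) e =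
  cong suc (weight-take-injective i j xs i≤ j≤ (+-cancelˡ-≡ x _ _ (suc-injective e)))
weight-take-injective zero    (suc j) (x ∷ xs) _ _ ()
weight-take-injective (suc i) zero    (x ∷ xs) _ _ ()

data Instruction (n : ℕ) : Set where
  op   : ℕ → Instruction n
  goto : Maybe (Fin n) → Instruction n

-- Instruction 0 is a jump to itself, the target of goto nothing.
module Labelled {n : ℕ} (block : Fin n → List (Instruction n))
                (nonempty : ∀ i → 0 < length (block i)) where

  blocks : List (Instruction n)
  blocks = concat (tabulate block)

  N : ℕ
  N = suc (length blocks)

  -- A jump lands on the 1 before its target, so the list must contain an instruction before it. The
  -- halting instruction is therefore addressed in the second copy, at `N`, and not at 0.
  entry : Maybe (Fin n) → ℕ
  entry nothing  = N
  entry (just i) = suc (offset block i)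

  -- j is the index of the instruction in the second copy of the program.
  resolve : ℕ → Instruction n → ℕ
  resolve j (op z)   = z
  resolve j (goto s) = 3 + (j ∸ entry s)

  resolveAll : ℕ → List (Instruction n) → List ℕ
  resolveAll j []       = []
  resolveAll j (x ∷ xs) = resolve j x ∷ resolveAll (suc j) xs

  resolveAll-++ : ∀ j xs ys → resolveAll j (xs ++ ys) ≡ resolveAll j xs ++ resolveAll (length xs + j) ys
  resolveAll-++ j []       ys = refl
  resolveAll-++ j (x ∷ xs) ys = cong (resolve j x ∷_) (trans (resolveAll-++ (suc j) xs ys)
    (cong (λ k → resolveAll (suc j) xs ++ resolveAll k ys) (+-suc (length xs) j)))

  length-resolveAll : ∀ j xs → length (resolveAll j xs) ≡ length xs
  length-resolveAll j []       = refl
  length-resolveAll j (x ∷ xs) = cong suc (length-resolveAll (suc j) xs)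

  open Program (resolveAll (suc N) blocks) public

  length-program : length program ≡ N
  length-program = cong suc (length-resolveAll (suc N) blocks)

  entry-just : ∀ i → entry (just i) < N
  entry-just i with concat-tabulate-split block i
  ... | xs , ys , e , l = s≤s (begin-strict
      offset block i                                  ≡⟨ l ⟨
      length xs                                       <⟨ m<m+n (length xs) (≤-trans (nonempty i) (m≤m+n _ (length ys))) ⟩
      length xs + (length (block i) + length ys)      ≡⟨ cong (length xs +_) (length-++ (block i)) ⟨
      length xs + length (block i ++ ys)              ≡⟨ length-++ xs ⟨
      length (xs ++ block i ++ ys)                    ≡⟨ cong length e ⟨
      length blocks                                   ∎)
    where open ≤-Reasoning

  entry-≤ : ∀ s → entry s ≤ N
  entry-≤ nothing  = ≤-refl
  entry-≤ (just i) = <⇒≤ (entry-just i)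

  entry-> : ∀ s → 0 < entry s
  entry-> nothing  = s≤s z≤n
  entry-> (just i) = s≤s z≤n

  entry-injective : ∀ s s′ → entry s ≡ entry s′ → s ≡ s′
  entry-injective nothing  nothing  e = refl
  entry-injective nothing  (just j) e = ⊥-elim (<⇒≢ (entry-just j) (sym e))
  entry-injective (just i) nothing  e = ⊥-elim (<⇒≢ (entry-just i) e)
  entry-injective (just i) (just j) e = cong just (offset-injective block nonempty (suc-injective e))

  location : Maybe (Fin n) → Fin (suc lastCell)
  location s = at (weight (take (entry s) program))

  at-around : ∀ i → at {lastCell} (weight program + i) ≡ at i
  at-around i = trans (cong at (begin
      weight program + i      ≡⟨ cong (_+ i) weight-program ⟩
      suc (lastCell + i)      ≡⟨ cong suc (+-comm lastCell i) ⟩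
      suc (i + lastCell)      ≡⟨ +-suc i lastCell ⟨
      i + suc lastCell        ∎))
    (at-cong (i + suc lastCell) i ([m+n]%n≡m%n i (suc lastCell)))
    where open ≡-Reasoning

  location-nothing : location nothing ≡ 0F
  location-nothing = begin
    at (weight (take N program))                              ≡⟨ cong (λ k → at (weight (take k program))) length-program ⟨
    at (weight (take (length program) program))               ≡⟨ cong (at ∘ weight) (take-all program) ⟩
    at (weight program)                                       ≡⟨ cong at (+-identityʳ (weight program)) ⟨
    at (weight program + 0)                                   ≡⟨ at-around 0 ⟩
    at 0                                                      ≡⟨ at-0 ⟩
    0F                                                        ∎
    where
    open ≡-Reasoning
    take-all : ∀ (xs : List ℕ) → take (length xs) xs ≡ xs
    take-all []       = refl
    take-all (x ∷ xs) = cong (x ∷_) (take-all xs)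

  toℕ-at-take : ∀ k → k < length program → toℕ (at {lastCell} (weight (take k program))) ≡ weight (take k program)
  toℕ-at-take k k< = trans (toℕ-at (weight (take k program)))
    (m<n⇒m%n≡m (subst (weight (take k program) <_) weight-program (weight-take-< k program k<)))

  entry-<-length : ∀ i → entry (just i) < length program
  entry-<-length i = subst (entry (just i) <_) (sym length-program) (entry-just i)

  location-just : ∀ i → location (just i) ≢ 0F
  location-just i e with trans (sym (toℕ-at-take (entry (just i)) (entry-<-length i))) (cong toℕ e)
  ... | ()

  -- This is what lets `δ` recover the state of `M` from the head of `P`. Partial weights increase
  -- strictly and those of blocks stay below the length of `P`; only the full weight, that of
  -- `nothing`, is reduced to 0, where no block starts.
  location-injective : ∀ s s′ → location s ≡ location s′ → s ≡ s′
  location-injective nothing  nothing  e = refl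
  location-injective nothing  (just j) e = ⊥-elim (location-just j (trans (sym e) location-nothing))
  location-injective (just i) nothing  e = ⊥-elim (location-just i (trans e location-nothing))
  location-injective (just i) (just j) e = entry-injective (just i) (just j)
    (weight-take-injective (entry (just i)) (entry (just j)) program (<⇒≤ (entry-<-length i)) (<⇒≤ (entry-<-length j))
      (trans (sym (toℕ-at-take (entry (just i)) (entry-<-length i)))
        (trans (cong toℕ e) (toℕ-at-take (entry (just j)) (entry-<-length j)))))

  split-length : ∀ {rx ys} → Split rx ys → length rx + length ys ≡ N + N
  split-length {rx} {ys} (split e) = begin
    length rx + length ys       ≡⟨ length-ʳ++ rx ⟨
    length (rx ʳ++ ys)          ≡⟨ cong length e ⟨
    length twice                ≡⟨ length-++ program ⟩
    length program + length program ≡⟨ cong₂ _+_ length-program length-program ⟩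
    N + N                       ∎
    where open ≡-Reasoning

  split-weight : ∀ {rx ys} → Split rx ys → weight rx ≡ weight (take (length rx) twice)
  split-weight {rx} {ys} (split e) = begin
    weight rx                                      ≡⟨ trans (weight-ʳ++ rx []) (+-identityʳ _) ⟨
    weight (reverse rx)                            ≡⟨ cong weight (++-identityʳ (reverse rx)) ⟨
    weight (reverse rx ++ [])                      ≡⟨ cong weight (take-length-++ (reverse rx) ys 0) ⟨
    weight (take (length (reverse rx) + 0) (reverse rx ++ ys))
      ≡⟨ cong₂ (λ k xs → weight (take k xs)) (trans (+-identityʳ _) (length-reverse rx))
           (trans (sym (ʳ++-defn rx)) (sym e)) ⟩
    weight (take (length rx) twice)                ∎
    where open ≡-Reasoning

  -- Past the halting instruction of the second copy every label lies behind, so each `goto` has a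
  -- target.
  record Point (rx ys : List ℕ) : Set where
    constructor point
    field
      isSplit   : Split rx ys
      afterHalt : N < length rx

  next : ∀ {rx z ys} → Point rx (z ∷ ys) → Point (z ∷ rx) ys
  next (point s N<) = point (split-next s) (m≤n⇒m≤1+n N<)

  -- With an instruction still to come, the offset into the second copy is positive and below one
  -- length of `P`, hence not 0 modulo that length.
  awake : ∀ {rx z ys} → Point rx (z ∷ ys) → Awake rx
  awake {rx} {z} {ys} (point s N<) e
    with length rx ∸ N | m+[n∸m]≡n (<⇒≤ N<)
  ... | zero  | eq = <⇒≢ N< (trans (sym (+-identityʳ N)) eq)
  ... | suc i | eq with trans (sym (trans (cong toℕ here≡) (toℕ-at-take (suc i) i<))) (cong toℕ e)
    where
    here≡ : at {lastCell} (weight rx) ≡ at (weight (take (suc i) program))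
    here≡ = trans (cong at (trans (split-weight s) (trans
      (cong weight (trans (cong (λ k → take k twice) (trans (sym eq) (cong (_+ suc i) (sym length-program)))) (take-length-++ program program (suc i))))
      (weight-++ program (take (suc i) program))))) (at-around _)
    i< : suc i < length program
    i< = subst (suc i <_) (sym length-program) (+-cancelˡ-< N (suc i) N
      (subst₂ _<_ (sym eq) (split-length s) (m<m+n (length rx) (s≤s z≤n))))
  ... | ()

  split-drop : ∀ k {rx ys} → Split rx ys → ∃[ ys′ ] Split (drop k rx) ys′
  split-drop zero    s = _ , s
  split-drop (suc k) {[]}     s = _ , s
  split-drop (suc k) {z ∷ rx} s = split-drop k (split-back s)

  split-location : ∀ {rx ys} s → Split rx ys → length rx ≡ entry s → at (weight rx) ≡ location s
  split-location {rx} s p e = cong at (trans (split-weight p) (cong weight (trans (cong (λ k → take k twice) e)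
    (take-++-≤ (entry s) program program (subst (entry s ≤_) (sym length-program) (entry-≤ s))))))

  exec-goto : ∀ s {rx ys w} → Point rx (3 + (length rx ∸ entry s) ∷ ys) → Word.under w ≡ 1F →
              ∃[ rx′ ] Reach κ (here rx w) (here rx′ w) × at (weight rx′) ≡ location s
  exec-goto s {rx} pt@(point p N<) u = drop k rx
      , exec-jump k p (awake pt) k< u
      , split-location s (proj₂ (split-drop k p)) (trans (length-drop k rx) (m∸[m∸n]≡n e≤))
    where
    k = length rx ∸ entry s
    e≤ : entry s ≤ length rx
    e≤ = ≤-trans (entry-≤ s) (<⇒≤ N<)
    k< : k < length rx
    k< = ∸-monoʳ-< (entry-> s) e≤

  -- A block label reached by a jump is described in the first copy. The same cell of `P` is
  -- described again in the second copy, so that the next block has room for its own jumps.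
  entered : ∀ i → ∃₂ λ rx ys → Point rx (resolveAll (length rx) (block i) ++ ys) × at (weight rx) ≡ location (just i)
  entered i with concat-tabulate-split block i
  ... | xs , ys , e , l = rx , resolveAll _ ys , point (split splits) N<rx , loc
    where
    open ≡-Reasoning
    pre = 3 ∷ resolveAll (suc N) xs
    rx = pre ʳ++ (program ʳ++ [])
    length-pre : length pre ≡ suc (length xs)
    length-pre = cong suc (length-resolveAll (suc N) xs)
    length-rx : length rx ≡ length xs + suc N
    length-rx = begin
      length rx                                  ≡⟨ length-ʳ++ pre ⟩
      length pre + length (program ʳ++ [])       ≡⟨ cong₂ _+_ length-pre (trans (length-ʳ++ program) (trans (+-identityʳ _) length-program)) ⟩
      suc (length xs) + N                        ≡⟨ +-suc (length xs) N ⟨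
      length xs + suc N                          ∎
    program≡ : program ≡ pre ++ resolveAll (length rx) (block i) ++ resolveAll (length (block i) + length rx) ys
    program≡ = cong (3 ∷_) (begin
      resolveAll (suc N) blocks                  ≡⟨ cong (resolveAll (suc N)) e ⟩
      resolveAll (suc N) (xs ++ block i ++ ys)   ≡⟨ resolveAll-++ (suc N) xs (block i ++ ys) ⟩
      resolveAll (suc N) xs ++ resolveAll (length xs + suc N) (block i ++ ys)
        ≡⟨ cong (λ j → resolveAll (suc N) xs ++ resolveAll j (block i ++ ys)) length-rx ⟨
      resolveAll (suc N) xs ++ resolveAll (length rx) (block i ++ ys)
        ≡⟨ cong (resolveAll (suc N) xs ++_) (resolveAll-++ (length rx) (block i) ys) ⟩
      _ ∎)
    splits : twice ≡ rx ʳ++ (resolveAll (length rx) (block i) ++ resolveAll (length (block i) + length rx) ys)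
    splits = begin
      program ++ program                         ≡⟨ cong (program ++_) program≡ ⟩
      program ++ pre ++ _                        ≡⟨ ʳ++-ʳ++ program ⟨
      (program ʳ++ []) ʳ++ (pre ++ _)            ≡⟨ ʳ++-ʳ++ pre ⟨
      rx ʳ++ _                                   ∎
    N<rx : N < length rx
    N<rx = subst (N <_) (sym length-rx) (m≤n+m (suc N) (length xs))
    loc : at (weight rx) ≡ location (just i)
    loc = begin
      at (weight rx)                                    ≡⟨ cong at (weight-ʳ++ pre (program ʳ++ [])) ⟩
      at (weight pre + weight (program ʳ++ []))         ≡⟨ cong (λ k → at (weight pre + k)) (trans (weight-ʳ++ program []) (+-identityʳ _)) ⟩
      at (weight pre + weight program)                  ≡⟨ cong at (+-comm (weight pre) (weight program)) ⟩
      at (weight program + weight pre)                  ≡⟨ at-around (weight pre) ⟩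
      at (weight pre)                                   ≡⟨ cong (at ∘ weight) (begin
          pre                                             ≡⟨ ++-identityʳ pre ⟨
          pre ++ []                                       ≡⟨ take-length-++ pre _ 0 ⟨
          take (length pre + 0) (pre ++ _)                ≡⟨ cong₂ take (trans (+-identityʳ _) (trans length-pre (cong suc l))) (sym program≡) ⟩
          take (entry (just i)) program                   ∎) ⟩
      location (just i)                                 ∎

  record Located (h : HConfig) (s : Maybe (Fin n)) (w : Word) : Set where
    constructor located
    field
      isq₁      : hstate h ≡ q₁
      atEntry   : pHead h ≡ location s
      atHome    : cHead h ≡ 0F
      describes : w describes wTape h

  run-block : ∀ {h i w s′ w′ k} →
    (∀ {rx ys} → Point rx (resolveAll (length rx) (block i) ++ ys) →
      ∃[ rx′ ] Reach k (here rx w) (here rx′ w′) × at (weight rx′) ≡ location s′) →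
    Located h (just i) w → ∃[ t ] suc t ≤ k × Located (hrun h (suc t)) s′ w′ × QuietBefore (suc t) h
  run-block {i = i} body (located e₁ e₂ e₃ d)
    with _ , _ , pt , here≡ ← entered i
    with rx′ , reach {t} path bound , there≡ ← body pt
    with agree f₁ f₂ f₃ d′ , quiet ← follow path (agree e₁ (trans e₂ (sym here≡)) (trans e₃ (sym at-0)) d)
    = t , bound , located f₁ (trans f₂ there≡) (trans f₃ at-0) d′ , quiet

  halted-loops : ∀ {h s w} → Located (hrun h s) nothing w → Word.under w ≡ 1F → LoopsFrom h s
  -- The self-jump runs back onto the 1 of the instruction before it on the circle. That is `z`, the
  -- last instruction of the first copy.
  halted-loops {h} {s} {w} (located e₁ e₂ e₃ d) u with ʳ++-∷ (resolveAll (suc N) blocks) 3 []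
  ... | z , rx , reversed = Circuit.loops-forever (halt-circuit {z} {rx} (split halves) (trans (read-described w T d) u)) (begin
      hrun h s                                            ≡⟨ assemble e₁ e₂ e₃ ⟩
      hconfig q₁ (location nothing) 0F T                  ≡⟨ cong₂ (λ i j → hconfig q₁ i j T) (trans location-nothing (sym at-start)) (sym at-0) ⟩
      hconfig q₁ (at (weight (z ∷ rx))) (at 0) T          ∎)
    where
    open ≡-Reasoning
    T = wTape (hrun h s)
    halves : twice ≡ (z ∷ rx) ʳ++ program
    halves = trans (sym (ʳ++-ʳ++ program)) (cong (_ʳ++ program) reversed)
    at-start : at (weight (z ∷ rx)) ≡ 0F
    at-start = trans (cong (at ∘ weight) (sym reversed)) (trans (cong at (weight-ʳ++ program [])) (trans (at-around 0) at-0))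
    assemble : ∀ {h q i j} → hstate h ≡ q → pHead h ≡ i → cHead h ≡ j → h ≡ hconfig q i j (wTape h)
    assemble refl refl refl = refl

-- A queue of bits on the work tape

cells₂ : List Bit → List Bit
cells₂ []        = []
cells₂ (0F ∷ bs) = 0F ∷ 1F ∷ cells₂ bs
cells₂ (1F ∷ bs) = 1F ∷ 0F ∷ cells₂ bs

cells₂ᴿ : List Bit → List Bit → List Bit
cells₂ᴿ []        l = l
cells₂ᴿ (0F ∷ bs) l = 1F ∷ 0F ∷ cells₂ᴿ bs l
cells₂ᴿ (1F ∷ bs) l = 0F ∷ 1F ∷ cells₂ᴿ bs l

cells₂-ʳ++ : ∀ bs rs l → cells₂ bs ʳ++ cells₂ᴿ rs l ≡ cells₂ᴿ (bs ʳ++ rs) l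
cells₂-ʳ++ []        rs l = refl
cells₂-ʳ++ (0F ∷ bs) rs l = cells₂-ʳ++ bs (0F ∷ rs) l
cells₂-ʳ++ (1F ∷ bs) rs l = cells₂-ʳ++ bs (1F ∷ rs) l

-- The head rests on the first cell of the last consumed pair. Before anything is consumed a dummy
-- pair 11 takes its place, so that the walk back always finds a pair to stop at.
queueWord : ℕ → List Bit → Word
queueWord c bs = word (replicate c 1F) 1F (1F ∷ cells₂ bs)

-- In state s, the automaton removes a letter b from the front of its queue,
-- appends the first component of τ s b and enters the state given by the
-- second, nothing standing for the halting state.
module Queue {n : ℕ} (τ : Fin n → Bit → List Bit × Maybe (Fin n)) where

  opaque
    -- The bit just read can be remembered only as a place in the program: `one s` is where `ask s`
    -- branches on a 1.
    ask one : Fin n → Fin (2 * n)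
    ask = combine {2} 0F
    one = combine {2} 1F

    blockOf : Fin (2 * n) → Fin 2 × Fin n
    blockOf = remQuot {2} n

    blockOf-ask : ∀ s → blockOf (ask s) ≡ (0F , s)
    blockOf-ask = remQuot-combine {2} 0F

    blockOf-one : ∀ s → blockOf (one s) ≡ (1F , s)
    blockOf-one = remQuot-combine {2} 1F

  -- Entered on the second cell of the free pair behind the queue; leaves on the
  -- first cell of the last consumed pair 11, which is marked, so that goto is taken.
  search : Maybe (Fin (2 * n)) → List (Instruction (2 * n))
  search s = op 2 ∷ goto s ∷ op 2 ∷ op 6 ∷ op 2 ∷ op 6 ∷ []

  -- Between letters the head is on the second cell of the next free pair.
  append : List Bit → List (Instruction (2 * n)) → List (Instruction (2 * n))
  append []       is = is
  append (0F ∷ o) is = op 0 ∷ op 1 ∷ op 1 ∷ append o is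
  append (1F ∷ o) is = op 2 ∷ op 0 ∷ op 1 ∷ op 1 ∷ op 1 ∷ append o is

  -- Entered on the first cell of the pair just consumed.
  answer : List Bit × Maybe (Fin n) → List (Instruction (2 * n))
  answer (o , s) = op 1 ∷ op 1 ∷ op 5 ∷ op 1 ∷ op 6 ∷ append o (search (Maybe.map ask s))

  -- The first cell of a pair equals its bit, hence the branch on it; in either branch the cell
  -- still blank is marked, which consumes the pair.
  blockFor : Fin 2 × Fin n → List (Instruction (2 * n))
  blockFor (0F , s) = op 1 ∷ op 1 ∷ goto (just (one s)) ∷ op 0 ∷ answer (τ s 0F)
  blockFor (1F , s) = op 1 ∷ op 0 ∷ op 2 ∷ answer (τ s 1F)

  block : Fin (2 * n) → List (Instruction (2 * n))
  block i = blockFor (blockOf i)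

  nonempty : ∀ i → 0 < length (block i)
  nonempty i with blockOf i
  ... | 0F , s = s≤s z≤n
  ... | 1F , s = s≤s z≤n

  open Labelled block nonempty public

  record Goes (k : ℕ) (x : Situation) (s : Maybe (Fin (2 * n))) (w : Word) : Set where
    constructor goes
    field
      {target}  : List ℕ
      reaches   : Reach (k * κ) x (here target w)
      isEntry   : at (weight target) ≡ location s

  infixr 5 _▸_

  _▸_ : ∀ {k x y s w} → Reach κ x y → Goes k y s w → Goes (suc k) x s w
  r ▸ goes r′ e = goes (r ⊛ r′) e

  slack : ∀ j {k x s w} → Goes k x s w → Goes (j + k) x s w
  slack j {k} (goes r e) = goes (weaken (*-monoˡ-≤ κ (m≤n+m k j)) r) e

  go : ∀ s {rx ys w} → Point rx (3 + (length rx ∸ entry s) ∷ ys) → Word.under w ≡ 1F → Goes 1 (here rx w) s w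
  go s p u = let (_ , r , e) = exec-goto s p u in goes (weaken (m≤m+n κ 0) r) e

  mark : ∀ {rx ys w} → Point rx (0 ∷ ys) → Reach κ (here rx w) (here (0 ∷ rx) (writeʷ 1F w))
  mark p = exec-mark (Point.isSplit p) (awake p)

  goR : ∀ {rx ys w} → Point rx (1 ∷ ys) → Reach κ (here rx w) (here (1 ∷ rx) (moveʷ R w))
  goR p = exec-right (Point.isSplit p) (awake p)

  goL : ∀ {rx ys w} → Point rx (2 ∷ ys) → Reach κ (here rx w) (here (2 ∷ rx) (moveʷ L w))
  goL p = exec-left (Point.isSplit p) (awake p)

  pass : ∀ k {rx ys w} → Point rx (3 + k ∷ ys) → Word.under w ≡ 0F → Reach κ (here rx w) (here (3 + k ∷ rx) w)
  pass k p u = exec-pass k (Point.isSplit p) (awake p) u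

  jump : ∀ k {rx ys w} → Point rx (3 + k ∷ ys) → k < length rx → Word.under w ≡ 1F → Reach κ (here rx w) (here (drop k rx) w)
  jump k p k< u = exec-jump k (Point.isSplit p) (awake p) k< u

  find# : ℕ → ℕ → ℕ
  find# zero    k = 3 + k
  find# (suc m) k = 4 + find# m k

  -- A walk to the right by pairs. A marked first cell is the bit 1, and `5` returns to the first of
  -- the two moves. A marked second cell after a blank first one is the bit 0, and `6` returns to
  -- the second move. Falling through both tests means a free pair.
  find-blank : ∀ bs l {k rx ys s w} → Point rx (1 ∷ 1 ∷ 5 ∷ 1 ∷ 6 ∷ ys) →
    Goes k (here (6 ∷ 1 ∷ 5 ∷ 1 ∷ 1 ∷ rx) (word (0F ∷ cells₂ bs ʳ++ l) 0F [])) s w →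
    Goes (find# (length bs) k) (here (1 ∷ 1 ∷ rx) (word l (first (cells₂ bs)) (drop 1 (cells₂ bs)))) s w
  find-blank []        l p g = pass 2 p₂ refl ▸ goR p₃ ▸ pass 3 p₄ refl ▸ g
    where p₂ = next (next p); p₃ = next p₂; p₄ = next p₃
  find-blank (0F ∷ bs) l p g = pass 2 p₂ refl ▸ goR p₃ ▸ jump 3 p₄ (s≤s (s≤s (s≤s (s≤s z≤n)))) refl ▸ goR (next p) ▸
    find-blank bs (1F ∷ 0F ∷ l) p g
    where p₂ = next (next p); p₃ = next p₂; p₄ = next p₃
  -- Three instructions against four for the bit 0; the slack makes the bound depend on the length
  -- only.
  find-blank (1F ∷ bs) l {rx = rx} p g = slack 1 (jump 2 p₂ (s≤s (s≤s (Point-nonempty p))) refl ▸ goR p ▸ goR (next p) ▸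
    find-blank bs (0F ∷ 1F ∷ l) p g)
    where
    p₂ = next (next p)
    Point-nonempty : ∀ {ys} → Point rx ys → 0 < length rx
    Point-nonempty (point _ N<) = ≤-trans (s≤s z≤n) N<

  append# : ℕ → ℕ → ℕ
  append# zero    k = k
  append# (suc m) k = 5 + append# m k

  appends : ∀ o is l {k rx ys s w} → Point rx (resolveAll (length rx) (append o is) ++ ys) →
    (∀ {rx′} → Point rx′ (resolveAll (length rx′) is ++ ys) → Goes k (here rx′ (word (0F ∷ cells₂ o ʳ++ l) 0F [])) s w) →
    Goes (append# (length o) k) (here rx (word (0F ∷ l) 0F [])) s w
  appends []       is l p g = g p
  appends (0F ∷ o) is l p g = slack 2 (mark p ▸ goR p₁ ▸ goR p₂ ▸ appends o is (1F ∷ 0F ∷ l) (next p₂) g)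
    where p₁ = next p; p₂ = next p₁
  appends (1F ∷ o) is l p g = goL p ▸ mark p₁ ▸ goR p₂ ▸ goR p₃ ▸ goR p₄ ▸ appends o is (0F ∷ 1F ∷ l) (next p₄) g
    where p₁ = next p; p₂ = next p₁; p₃ = next p₂; p₄ = next p₃

  search# : ℕ → ℕ
  search# zero    = 3
  search# (suc m) = 4 + search# m

  -- A walk to the left, joined at the test of a second cell. If that cell is marked, the pair is
  -- the bit 0 or consumed, and `goto s` on the first cell tells which. If it is blank, the pair is
  -- the bit 1, whose marked first cell makes the last jump certain.
  searches : ∀ s rs l r {rx ys} → Point rx (resolveAll (length rx) (search s) ++ ys) →
    Goes (search# (length rs)) (here (2 ∷ resolve (suc (length rx)) (goto s) ∷ 2 ∷ rx)
          (word (drop 1 (cells₂ᴿ rs (1F ∷ 1F ∷ l))) (first (cells₂ᴿ rs (1F ∷ 1F ∷ l))) (cells₂ r ++ 0F ∷ 0F ∷ [])))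
         s (word l 1F (1F ∷ cells₂ (rs ʳ++ r) ++ 0F ∷ 0F ∷ []))
  searches s []        l r p = jump 3 p₃ (s≤s (s≤s (s≤s (≤-trans (s≤s z≤n) (Point.afterHalt p))))) refl ▸ goL p ▸ go s (next p) refl
    where p₁ = next p; p₂ = next p₁; p₃ = next p₂
  searches s (0F ∷ rs) l r p = jump 3 p₃ (s≤s (s≤s (s≤s (≤-trans (s≤s z≤n) (Point.afterHalt p))))) refl ▸ goL p ▸ pass _ (next p) refl ▸ goL p₂ ▸
    searches s rs l (0F ∷ r) p
    where p₁ = next p; p₂ = next p₁; p₃ = next p₂
  searches s (1F ∷ rs) l r p = pass 3 p₃ refl ▸ goL p₄ ▸ jump 3 (next p₄) (s≤s (s≤s (s≤s (s≤s z≤n)))) refl ▸ goL p₂ ▸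
    searches s rs l (1F ∷ r) p
    where p₁ = next p; p₂ = next p₁; p₃ = next p₂; p₄ = next p₃

  answer# : ℕ → ℕ → ℕ
  answer# b o = 2 + find# b (append# o (3 + search# (o + (b + 0))))

  answers : ∀ o s bs l {rx ys} → Point rx (resolveAll (length rx) (answer (o , s)) ++ ys) →
    Goes (answer# (length bs) (length o)) (here rx (word l 1F (1F ∷ cells₂ bs)))
         (Maybe.map ask s) (word l 1F (1F ∷ cells₂ (bs ++ o) ++ 0F ∷ 0F ∷ []))
  answers o s bs l {rx} {ys} p = goR p ▸ goR (next p) ▸ find-blank bs (1F ∷ 1F ∷ l) p
    (appends o (search (Maybe.map ask s)) (cells₂ bs ʳ++ 1F ∷ 1F ∷ l) (next (next (next (next (next p))))) λ {rx′} q →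
      subst (λ l′ → Goes (3 + search# (length o + (length bs + 0))) (here rx′ (word (0F ∷ l′) 0F [])) (Maybe.map ask s)
                     (word l 1F (1F ∷ cells₂ (bs ++ o) ++ 0F ∷ 0F ∷ []))) (sym left≡)
        (goL q ▸ pass _ (next q) refl ▸ goL (next (next q)) ▸
          finish (searches (Maybe.map ask s) rs l [] q)))
    where
    rs = o ʳ++ (bs ʳ++ [])
    left≡ : cells₂ o ʳ++ (cells₂ bs ʳ++ 1F ∷ 1F ∷ l) ≡ cells₂ᴿ rs (1F ∷ 1F ∷ l)
    left≡ = trans (cong (cells₂ o ʳ++_) (cells₂-ʳ++ bs [] (1F ∷ 1F ∷ l))) (cells₂-ʳ++ o (bs ʳ++ []) (1F ∷ 1F ∷ l))
    queue≡ : rs ʳ++ [] ≡ bs ++ o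
    queue≡ = trans (ʳ++-ʳ++ o) (trans (ʳ++-ʳ++ bs) (cong (bs ++_) (++-identityʳ o)))
    finish : ∀ {x} → Goes (search# (length rs)) x (Maybe.map ask s) (word l 1F (1F ∷ cells₂ (rs ʳ++ []) ++ 0F ∷ 0F ∷ [])) →
             Goes (search# (length o + (length bs + 0))) x (Maybe.map ask s) (word l 1F (1F ∷ cells₂ (bs ++ o) ++ 0F ∷ 0F ∷ []))
    finish {x} = subst₂ (λ j bs′ → Goes j x (Maybe.map ask s) (word l 1F (1F ∷ cells₂ bs′ ++ 0F ∷ 0F ∷ [])))
      (cong search# (trans (length-ʳ++ o) (cong (length o +_) (length-ʳ++ bs)))) queue≡

  record Run (k : ℕ) (h : HConfig) (s : Maybe (Fin (2 * n))) (w : Word) : Set where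
    constructor run
    field
      {lasting} : ℕ
      within    : suc lasting ≤ k
      arrives   : Located (hrun h (suc lasting)) s w
      silent    : QuietBefore (suc lasting) h

  run-goes : ∀ {k h i w s w′} →
    (∀ {rx ys} → Point rx (resolveAll (length rx) (block i) ++ ys) → Goes k (here rx w) s w′) →
    Located h (just i) w → Run (k * κ) h s w′
  run-goes body lo =
    let (_ , b , lo′ , q) = run-block (λ p → let goes r e = body p in _ , r , e) lo in run b lo′ q

  joined : ∀ {j k h s w s′ w′} (r : Run j h s w) → Run k (hrun h (suc (Run.lasting r))) s′ w′ → Run (j + k) h s′ w′
  joined {h = h} (run {t} b lo q) (run {t′} b′ lo′ q′) =
    run (+-mono-≤ b b′) (subst (λ h′ → Located h′ _ _) (sym (hrun-+ h (suc t) (suc t′))) lo′)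
        (QuietBefore-+ (suc t) (suc t′) q q′)

  infixr 5 _⊚_

  _⊚_ : ∀ {j k h s w s′ w′} → Run j h s w → (∀ {h′} → Located h′ s w → Run k h′ s′ w′) → Run (j + k) h s′ w′
  run b lo q ⊚ f = joined (run b lo q) (f lo)

  run-≤ : ∀ {j k h s w} → j ≤ k → Run j h s w → Run k h s w
  run-≤ j≤k (run b lo q) = run (≤-trans b j≤k) lo q

  requeue : ∀ {k h s c bs bs′} → bs ≡ bs′ → Run k h s (queueWord c bs) → Run k h s (queueWord c bs′)
  requeue refl r = r

  relocate : ∀ {h s c bs bs′} → bs ≡ bs′ → Located h s (queueWord c bs) → Located h s (queueWord c bs′)
  relocate refl lo = lo

  trim : ∀ c bs {k h s} → Run k h s (word (replicate c 1F) 1F (1F ∷ cells₂ bs ++ 0F ∷ 0F ∷ [])) →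
         Run k h s (queueWord c bs)
  trim c bs (run b (located e₁ e₂ e₃ d) q) = run b (located e₁ e₂ e₃ λ z → trans (d z)
    (trans (cong (λ l → layout (word l 1F (1F ∷ cells₂ bs ++ 0F ∷ 0F ∷ [])) z) (sym (++-identityʳ (replicate c 1F))))
      (layout-pad 0 2 (replicate c 1F) 1F (1F ∷ cells₂ bs) z))) q

  letter# : ℕ → ℕ → ℕ
  letter# b o = 6 + answer# b o

  run-letter : ∀ s b c bs {h} → Located h (just (ask s)) (queueWord c (b ∷ bs)) →
    let (o , s′) = τ s b in
    Run (letter# (length bs) (length o) * κ) h (Maybe.map ask s′) (queueWord (2 + c) (bs ++ o))
  run-letter s 0F c bs lo = trim (2 + c) (bs ++ proj₁ (τ s 0F)) (run-goes body lo)
    where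
    body : ∀ {rx ys} → Point rx (resolveAll (length rx) (block (ask s)) ++ ys) →
           Goes (letter# (length bs) (length (proj₁ (τ s 0F)))) (here rx (queueWord c (0F ∷ bs))) _ _
    body p rewrite blockOf-ask s =
      slack 2 (goR p ▸ goR p₁ ▸ pass _ p₂ refl ▸ mark p₃ ▸ answers (proj₁ (τ s 0F)) (proj₂ (τ s 0F)) bs (replicate (2 + c) 1F) (next p₃))
      where p₁ = next p; p₂ = next p₁; p₃ = next p₂
  run-letter s 1F c bs lo =
    run-≤ (≤-reflexive (sym (*-distribʳ-+ κ 3 (3 + answer# (length bs) (length (proj₁ (τ s 1F)))))))
      (run-goes branch lo ⊚ λ lo′ → trim (2 + c) (bs ++ proj₁ (τ s 1F)) (run-goes body lo′))
    where
    w′ = word (replicate (2 + c) 1F) 1F (0F ∷ cells₂ bs)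
    branch : ∀ {rx ys} → Point rx (resolveAll (length rx) (block (ask s)) ++ ys) →
             Goes 3 (here rx (queueWord c (1F ∷ bs))) (just (one s)) w′
    branch p rewrite blockOf-ask s = goR p ▸ goR (next p) ▸ go (just (one s)) (next (next p)) refl
    body : ∀ {rx ys} → Point rx (resolveAll (length rx) (block (one s)) ++ ys) →
           Goes (3 + answer# (length bs) (length (proj₁ (τ s 1F)))) (here rx w′) _ _
    body p rewrite blockOf-one s =
      goR p ▸ mark (next p) ▸ goL (next (next p)) ▸ answers (proj₁ (τ s 1F)) (proj₂ (τ s 1F)) bs (replicate (2 + c) 1F) (next (next (next p)))

  -- Four instructions out and four back for each waiting bit; five to write and four to walk back
  -- over each appended one.
  letter#≡ : ∀ b o → letter# b o ≡ 17 + 8 * b + 9 * o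
  letter#≡ b o = begin
    8 + find# b (append# o (3 + search# (o + (b + 0))))    ≡⟨ cong (8 +_) (find#≡ b _) ⟩
    8 + (4 * b + (3 + append# o _))                        ≡⟨ cong (λ k → 8 + (4 * b + (3 + k))) (append#≡ o _) ⟩
    8 + (4 * b + (3 + (5 * o + (3 + search# (o + (b + 0))))))
      ≡⟨ cong (λ k → 8 + (4 * b + (3 + (5 * o + (3 + k))))) (search#≡ (o + (b + 0))) ⟩
    8 + (4 * b + (3 + (5 * o + (3 + (4 * (o + (b + 0)) + 3)))))
      ≡⟨ solve 2 (λ b o → con 8 :+ (con 4 :* b :+ (con 3 :+ (con 5 :* o :+ (con 3 :+ (con 4 :* (o :+ (b :+ con 0)) :+ con 3)))))
                  := con 17 :+ con 8 :* b :+ con 9 :* o) refl b o ⟩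
    17 + 8 * b + 9 * o                                     ∎
    where
    open ≡-Reasoning
    open +-*-Solver
    find#≡ : ∀ m k → find# m k ≡ 4 * m + (3 + k)
    find#≡ zero    k = refl
    find#≡ (suc m) k = trans (cong (4 +_) (find#≡ m k))
      (solve 2 (λ m k → con 4 :+ (con 4 :* m :+ (con 3 :+ k))
                    := con 4 :* (con 1 :+ m) :+ (con 3 :+ k)) refl m k)
    append#≡ : ∀ m k → append# m k ≡ 5 * m + k
    append#≡ zero    k = refl
    append#≡ (suc m) k = trans (cong (5 +_) (append#≡ m k))
      (solve 2 (λ m k → con 5 :+ (con 5 :* m :+ k) := con 5 :* (con 1 :+ m) :+ k) refl m k)
    search#≡ : ∀ m → search# m ≡ 4 * m + 3
    search#≡ zero    = refl
    search#≡ (suc m) = trans (cong (4 +_) (search#≡ m))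
      (solve 1 (λ m → con 4 :+ (con 4 :* m :+ con 3) := con 4 :* (con 1 :+ m) :+ con 3) refl m)

-- One pass through the queue for each step of the simulated machine

Symbol : Set
Symbol = Bit × Bit

-- The first half separates tape cells from punctuation.
pattern plain b = 0F , b
pattern hat     = 1F , 1F
pattern end     = 1F , 0F

plains : List Bit → List Symbol
plains = map (λ b → plain b)

flat : List Symbol → List Bit
flat []             = []
flat ((a , b) ∷ ss) = a ∷ b ∷ flat ss

flat-++ : ∀ ss ss′ → flat (ss ++ ss′) ≡ flat ss ++ flat ss′
flat-++ []             ss′ = refl
flat-++ ((a , b) ∷ ss) ss′ = cong (λ bs → a ∷ b ∷ bs) (flat-++ ss ss′)

length-flat : ∀ ss → length (flat ss) ≡ 2 * length ss
length-flat []       = refl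
length-flat (s ∷ ss) = trans (cong (2 +_) (length-flat ss)) (sym (*-suc 2 (length ss)))

queueOf : Word → List Symbol
queueOf (word l x r) = plains (reverse l) ++ hat ∷ plain x ∷ plains r ++ end ∷ []

pad : Word → Word
pad (word l x r) = word (l ++ 0F ∷ []) x (r ++ 0F ∷ [])

first∷drop : ∀ r → first (r ++ 0F ∷ []) ∷ drop 1 (r ++ 0F ∷ []) ≡ r ++ 0F ∷ []
first∷drop []      = refl
first∷drop (x ∷ r) = refl

reverse-pad : ∀ (l : List Bit) → reverse (l ++ 0F ∷ []) ≡ 0F ∷ reverse l
reverse-pad l = reverse-++ l (0F ∷ [])

-- The pass starts with a blank withheld, then reads the left part. What it holds on meeting `hat`
-- is the left neighbour of the scanned cell, a fresh blank if the left part is empty.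
reverse-first : ∀ l → 0F ∷ reverse l ≡ reverse (drop 1 (l ++ 0F ∷ [])) ++ first (l ++ 0F ∷ []) ∷ []
reverse-first l = begin
  0F ∷ reverse l                                       ≡⟨ reverse-pad l ⟨
  reverse (l ++ 0F ∷ [])                               ≡⟨ cong reverse (first∷drop l) ⟨
  reverse (first (l ++ 0F ∷ []) ∷ drop 1 (l ++ 0F ∷ [])) ≡⟨ unfold-reverse _ (drop 1 (l ++ 0F ∷ [])) ⟩
  _                                                    ∎
  where open ≡-Reasoning

opaque
  pack : ∀ {a b c d} → Fin a → Fin b → Fin c → Fin d → Fin (a * (b * (c * d)))
  pack i j k l = combine i (combine j (combine k l))

  unpack : ∀ a b c d → Fin (a * (b * (c * d))) → Fin a × Fin b × Fin c × Fin d
  unpack a b c d = map₂ (map₂ (remQuot {c} d) ∘ remQuot {b} (c * d)) ∘ remQuot {a} (b * (c * d))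

  unpack-pack : ∀ {a b c d} (i : Fin a) (j : Fin b) (k : Fin c) (l : Fin d) →
                unpack a b c d (pack i j k l) ≡ (i , j , k , l)
  unpack-pack {a} {b} {c} {d} i j k l =
    trans (cong (map₂ (map₂ (remQuot {c} d) ∘ remQuot {b} (c * d))) (remQuot-combine i (combine j (combine k l))))
      (cong (i ,_) (trans (cong (map₂ (remQuot {c} d)) (remQuot-combine j (combine k l)))
        (cong (j ,_) (remQuot-combine k l))))

-- The queue holds the tape from left to right, the scanned cell preceded by
-- hat, and then end.
module Simulation (M : BinaryTM) where

  open BinaryTM M

  -- Phases: before the head, with the last cell read withheld so that hat can
  -- still be put in front of it; at the head, with the left neighbour
  -- withheld; after the head.
  pattern before = 0F
  pattern scanning = 1F
  pattern after  = 2F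

  n : ℕ
  n = suc lastState * (3 * (2 * 3))

  -- The last component is 0F at the start of a symbol and suc a after its first
  -- half a.
  control : State → Fin 3 → Bit → Fin 3 → Fin n
  control = pack

  uncontrol : Fin n → State × Fin 3 × Bit × Fin 3
  uncontrol = unpack (suc lastState) 3 2 3

  -- By `f-undefined`, the value at one symbol decides whether the state halts, so halting is known
  -- before the scanned cell is read. The withheld `0F` becomes the blank added on the left by the
  -- next pass.
  ready : State → Maybe (Fin n)
  ready q = Maybe.map (λ _ → control q before 0F 0F) (f q 0F)

  around : Direction → Bit → Bit → List Symbol
  around L y x = hat ∷ plain y ∷ plain x ∷ []
  around R y x = plain y ∷ plain x ∷ hat ∷ []

  perform : Maybe (Bit × Direction × State) → Bit → List Symbol × Maybe (Fin n)
  perform nothing             y = [] , nothing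
  perform (just (x , D , q′)) y = around D y x , just (control q′ after 0F 0F)

  σ : State × Fin 3 × Bit → Symbol → List Symbol × Maybe (Fin n)
  σ (q , before   , y) (0F , b) = plain y ∷ [] , just (control q before b 0F)
  σ (q , before   , y) (1F , _) = [] , just (control q scanning y 0F)
  σ (q , scanning , y) (_  , x) = perform (f q x) y
  σ (q , after    , _) (0F , b) = plain b ∷ [] , just (control q after 0F 0F)
  σ (q , after    , _) (1F , _) = plain 0F ∷ end ∷ [] , ready q

  σ-short : ∀ k s → length (proj₁ (σ k s)) ≤ 3
  σ-short (q , before   , y) (0F , b) = s≤s z≤n
  σ-short (q , before   , y) (1F , _) = z≤n
  σ-short (q , scanning , y) (_  , x) with f q x
  ... | nothing            = z≤n
  ... | just (_ , L , _)   = ≤-refl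
  ... | just (_ , R , _)   = ≤-refl
  σ-short (q , after    , _) (0F , b) = s≤s z≤n
  σ-short (q , after    , _) (1F , _) = s≤s (s≤s z≤n)

  τ′ : State × Fin 3 × Bit × Fin 3 → Bit → List Bit × Maybe (Fin n)
  τ′ (q , p , y , 0F)        b = [] , just (control q p y (Fin.suc b))
  τ′ (q , p , y , Fin.suc a) b = flat (proj₁ (σ (q , p , y) (a , b))) , proj₂ (σ (q , p , y) (a , b))

  τ : Fin n → Bit → List Bit × Maybe (Fin n)
  τ i = τ′ (uncontrol i)

  open Queue τ public

  label : Maybe (Fin n) → Maybe (Fin (2 * n))
  label = Maybe.map ask

  -- Bounds the cost of a symbol while the queue has at most Q symbols.
  opaque
    unit : ℕ → ℕ
    unit Q = (88 + 32 * Q) * κ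

    unit≡ : ∀ Q → unit Q ≡ (88 + 32 * Q) * κ
    unit≡ Q = refl

  run-symbol : ∀ Q q p y s ss {c h} → length ss < Q →
    Located h (just (ask (control q p y 0F))) (queueWord c (flat (s ∷ ss))) →
    Run (unit Q) h (label (proj₂ (σ (q , p , y) s))) (queueWord (4 + c) (flat (ss ++ proj₁ (σ (q , p , y) s))))
  run-symbol Q q p y (a , b) ss {c} short lo = run-≤ cost
    (half₁ ⊚ λ lo′ → requeue (sym (flat-++ ss out)) (half₂ lo′))
    where
    out = proj₁ (σ (q , p , y) (a , b))
    half₁ : Run (letter# (suc (length (flat ss))) 0 * κ) _ (just (ask (control q p y (Fin.suc a)))) (queueWord (2 + c) (b ∷ flat ss))
    half₁ = subst₂ (λ o bs → Run (letter# (suc (length (flat ss))) (length (proj₁ o)) * κ) _ (label (proj₂ o)) (queueWord (2 + c) (b ∷ bs)))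
      (cong (λ k → τ′ k a) (unpack-pack q p y 0F))
      (trans (cong (λ k → flat ss ++ proj₁ (τ′ k a)) (unpack-pack q p y 0F)) (++-identityʳ (flat ss)))
      (run-letter (control q p y 0F) a c (b ∷ flat ss) lo)
    half₂ : ∀ {h} → Located h (just (ask (control q p y (Fin.suc a)))) (queueWord (2 + c) (b ∷ flat ss)) →
            Run (letter# (length (flat ss)) (length (flat out)) * κ) h (label (proj₂ (σ (q , p , y) (a , b)))) (queueWord (4 + c) (flat ss ++ flat out))
    half₂ lo = subst (λ o → Run (letter# (length (flat ss)) (length (proj₁ o)) * κ) _ (label (proj₂ o)) (queueWord (4 + c) (flat ss ++ proj₁ o)))
      (cong (λ k → τ′ k b) (unpack-pack q p y (Fin.suc a)))
      (run-letter (control q p y (Fin.suc a)) b (2 + c) (flat ss) lo)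
    -- Either letter faces fewer than `2 * Q` waiting bits, and the answer has at most three
    -- symbols, so six bits: `88 = 17 + 17 + 9 * 6` and `32 = 2 * (8 * 2)`.
    cost : letter# (suc (length (flat ss))) 0 * κ + letter# (length (flat ss)) (length (flat out)) * κ ≤ unit Q
    cost = begin
      letter# (suc m) 0 * κ + letter# m o * κ                ≡⟨ *-distribʳ-+ κ (letter# (suc m) 0) (letter# m o) ⟨
      (letter# (suc m) 0 + letter# m o) * κ                  ≤⟨ *-monoˡ-≤ κ (begin
        letter# (suc m) 0 + letter# m o                        ≡⟨ cong₂ _+_ (letter#≡ (suc m) 0) (letter#≡ m o) ⟩
        17 + 8 * suc m + 9 * 0 + (17 + 8 * m + 9 * o)          ≤⟨ +-mono-≤ (+-monoˡ-≤ (9 * 0) (+-monoʳ-≤ 17 (*-monoʳ-≤ 8 m<)))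
                                                                   (+-mono-≤ (+-monoʳ-≤ 17 (*-monoʳ-≤ 8 (≤-trans (n≤1+n m) m<))) (*-monoʳ-≤ 9 o≤)) ⟩
        17 + 8 * (2 * Q) + 9 * 0 + (17 + 8 * (2 * Q) + 9 * 6)
          ≡⟨ solve 1 (λ Q → con 17 :+ con 8 :* (con 2 :* Q) :+ con 0 :+ (con 17 :+ con 8 :* (con 2 :* Q) :+ con 54)
                            := con 88 :+ con 32 :* Q) refl Q ⟩
        88 + 32 * Q                                            ∎) ⟩
      (88 + 32 * Q) * κ                                      ≡⟨ unit≡ Q ⟨
      unit Q                                                 ∎
      where
      open ≤-Reasoning
      open +-*-Solver
      m = length (flat ss)
      o = length (flat out)
      m< : suc m ≤ 2 * Q
      m< = ≤-trans
        (≤-trans (n≤1+n (suc m)) (≤-reflexive (trans (cong (2 +_) (length-flat ss)) (sym (*-suc 2 (length ss))))))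
        (*-monoʳ-≤ 2 short)
      o≤ : o ≤ 6
      o≤ = subst (_≤ 6) (sym (length-flat out)) (*-monoʳ-≤ 2 (σ-short (q , p , y) (a , b)))

  record Pass (Q k : ℕ) (h : HConfig) (s : Maybe (Fin n)) (ss : List Symbol) : Set where
    constructor passed
    field
      {consumed} : ℕ
      passing    : Run (k * unit Q) h (label s) (queueWord consumed (flat ss))

  infixr 5 _⟫_

  _⟫_ : ∀ {Q k h s c ss s′ ss′} → Run (unit Q) h (label s) (queueWord c (flat ss)) →
        (∀ {h′} → Located h′ (label s) (queueWord c (flat ss)) → Pass Q k h′ s′ ss′) → Pass Q (suc k) h s′ ss′
  run b lo q ⟫ g = let passed r = g lo in passed (joined (run b lo q) r)

  pass-queue : ∀ {Q k h s ss ss′} → ss ≡ ss′ → Pass Q k h s ss → Pass Q k h s ss′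
  pass-queue refl r = r

  rotate : ∀ (ss ss′ : List Symbol) s → (ss ++ ss′) ++ s ∷ [] ≡ ss ++ ss′ ++ s ∷ []
  rotate ss ss′ s = ++-assoc ss ss′ (s ∷ [])

  rotate-length : ∀ {Q} (ss ss′ : List Symbol) s → suc (length (ss ++ ss′)) ≤ Q → length (ss ++ ss′ ++ s ∷ []) ≤ Q
  rotate-length ss ss′ s short = subst (_≤ _)
    (trans (+-comm 1 _) (trans (sym (length-++ (ss ++ ss′))) (cong length (rotate ss ss′ s)))) short

  -- A delay line: `zs` is read and the same sequence, one symbol late, is written. Each plain
  -- symbol is replaced by one symbol, so the bound `Q` persists.
  holding : ∀ {Q k q y y′ s ss} zs init rest {c h} → y ∷ zs ≡ init ++ y′ ∷ [] →
    length (plains zs ++ hat ∷ rest) ≤ Q →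
    Located h (just (ask (control q before y 0F))) (queueWord c (flat (plains zs ++ hat ∷ rest))) →
    (∀ {c h} → Located h (just (ask (control q scanning y′ 0F))) (queueWord c (flat (rest ++ plains init))) → Pass Q k h s ss) →
    Pass Q (suc (length zs) + k) h s ss
  holding {Q} {q = q} {y} [] [] rest refl short lo g =
    run-symbol Q q before y hat rest short lo ⟫ g
  holding [] (_ ∷ [])    rest () short lo g
  holding [] (_ ∷ _ ∷ _) rest () short lo g
  holding (_ ∷ _) []     rest () short lo g
  holding {Q} {q = q} {y} (z ∷ zs) (a ∷ init) rest e short lo g =
    run-symbol Q q before y (plain z) (plains zs ++ hat ∷ rest) short lo ⟫ λ lo′ →
    holding zs init (rest ++ plain y ∷ []) (∷-injectiveʳ e) (rotate-length (plains zs) (hat ∷ rest) (plain y) short)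
      (relocate (cong flat (rotate (plains zs) (hat ∷ rest) (plain y))) lo′)
      (λ lo″ → g (relocate (cong flat (trans (++-assoc rest (plain y ∷ []) (plains init))
        (cong (λ b → rest ++ plain b ∷ plains init) (∷-injectiveˡ e)))) lo″))

  copying : ∀ {Q q} zs rest {c h} → length (plains zs ++ end ∷ rest) ≤ Q →
    Located h (just (ask (control q after 0F 0F))) (queueWord c (flat (plains zs ++ end ∷ rest))) →
    Pass Q (suc (length zs)) h (ready q) (rest ++ plains zs ++ plain 0F ∷ end ∷ [])
  copying {Q} {q} [] rest short lo = passed (run-≤ (m≤m+n _ 0) (run-symbol Q q after 0F end rest short lo))
  copying {Q} {q} (z ∷ zs) rest short lo =
    run-symbol Q q after 0F (plain z) (plains zs ++ end ∷ rest) short lo ⟫ λ lo′ →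
    pass-queue (++-assoc rest (plain z ∷ []) (plains zs ++ plain 0F ∷ end ∷ []))
      (copying zs (rest ++ plain z ∷ []) (rotate-length (plains zs) (end ∷ rest) (plain z) short)
        (relocate (cong flat (rotate (plains zs) (end ∷ rest) (plain z))) lo′))

  performing : ∀ Q {q y x x′ D q′} ss {c h} → f q x ≡ just (x′ , D , q′) → length ss < Q →
    Located h (just (ask (control q scanning y 0F))) (queueWord c (flat (plain x ∷ ss))) →
    Run (unit Q) h (just (ask (control q′ after 0F 0F)))
        (queueWord (4 + c) (flat (ss ++ around D y x′)))
  performing Q {q} {y} {x} ss {c} e short lo =
    subst (λ r → Run (unit Q) _ (label (proj₂ (perform r y))) (queueWord (4 + c) (flat (ss ++ proj₁ (perform r y))))) e
      (run-symbol Q q scanning y (plain x) ss short lo)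

  nextʷ : Bit → Direction → Word → Word
  nextʷ x D w = moveʷ D (writeʷ x (pad w))

  extent : Word → ℕ
  extent (word l _ r) = length l + length r

  plains-pad : ∀ r → plains r ++ plain 0F ∷ end ∷ [] ≡ plains (r ++ 0F ∷ []) ++ end ∷ []
  plains-pad r = trans (sym (++-assoc (plains r) (plain 0F ∷ []) (end ∷ []))) (cong (_++ end ∷ []) (sym (map-++ _ r (0F ∷ []))))

  simulate : ∀ w {q x D q′ c h} → f q (Word.under w) ≡ just (x , D , q′) →
    Located h (just (ask (control q before 0F 0F))) (queueWord c (flat (queueOf w))) →
    Pass (4 + extent w) (3 + extent w) h (ready q′) (queueOf (nextʷ x D w))
  simulate w@(word l x r) {q} {x′} {D} {q′} {h = h} e lo =
    subst (λ k → Pass Q k h (ready q′) (queueOf (nextʷ x′ D w))) rounds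
      (holding (reverse l) init (plain x ∷ plains r ++ end ∷ []) (reverse-first l) short lo λ lo₁ →
        performing Q ((plains r ++ end ∷ []) ++ plains init) e short₁ lo₁ ⟫ λ lo₂ → written D refl lo₂)
    where
    open +-*-Solver using (solve; _:=_; _:+_; con)
    -- The queue starts with `3 + extent w` symbols, loses one at `hat` and gains two at the scanned
    -- cell. The growth at `end` is left to the next pass.
    Q    = 4 + extent w
    y    = first (l ++ 0F ∷ [])
    init = reverse (drop 1 (l ++ 0F ∷ []))
    length-init : length init ≡ length l
    length-init = suc-injective (trans (+-comm 1 (length init)) (trans (sym (length-++ init))
      (trans (cong length (sym (reverse-first l))) (cong suc (length-reverse l)))))
    length-plains : ∀ bs ss → length (plains bs ++ ss) ≡ length bs + length ss
    length-plains bs ss = trans (length-++ (plains bs)) (cong (_+ length ss) (length-map _ bs))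
    rounds : suc (length (reverse l)) + suc (suc (length r)) ≡ 3 + extent w
    rounds = cong suc (trans (cong (_+ suc (suc (length r))) (length-reverse l))
      (trans (+-suc (length l) (suc (length r))) (cong suc (+-suc (length l) (length r)))))
    short : length (queueOf w) ≤ Q
    short = ≤-trans (≤-reflexive (trans (length-plains (reverse l) _) (trans
      (cong₂ (λ i j → i + suc (suc j)) (length-reverse l) (length-plains r (end ∷ [])))
      (solve 2 (λ i j → i :+ (con 2 :+ (j :+ con 1)) := con 3 :+ (i :+ j)) refl (length l) (length r))))) (n≤1+n _)
    short₁ : length ((plains r ++ end ∷ []) ++ plains init) < Q
    short₁ = ≤-trans (≤-reflexive (cong suc (trans (length-++ (plains r ++ end ∷ []))
      (trans (cong₂ _+_ (length-plains r (end ∷ [])) (trans (length-map _ init) length-init))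
      (solve 2 (λ i j → j :+ con 1 :+ i := con 1 :+ (i :+ j)) refl (length l) (length r)))))) (≤-trans (n≤1+n _) (n≤1+n _))
    short₂ : ∀ a b c → length (plains r ++ end ∷ plains init ++ a ∷ b ∷ c ∷ []) ≤ Q
    short₂ a b c = ≤-reflexive (trans (length-plains r _)
      (trans (cong (λ j → length r + suc j) (trans (length-plains init _) (cong (_+ 3) length-init)))
      (solve 2 (λ i j → j :+ (con 1 :+ (i :+ con 3)) := con 4 :+ (i :+ j)) refl (length l) (length r))))
    turned : ∀ ss → ((plains r ++ end ∷ []) ++ plains init) ++ ss ≡ plains r ++ end ∷ plains init ++ ss
    turned ss = trans (++-assoc (plains r ++ end ∷ []) (plains init) ss) (++-assoc (plains r) (end ∷ []) (plains init ++ ss))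
    ending : plains r ++ plain 0F ∷ end ∷ [] ≡ plains (first (r ++ 0F ∷ []) ∷ drop 1 (r ++ 0F ∷ [])) ++ end ∷ []
    ending = trans (plains-pad r) (cong (λ bs → plains bs ++ end ∷ []) (sym (first∷drop r)))
    beginning : plains init ++ plain y ∷ plain x′ ∷ [] ≡ plains (reverse (x′ ∷ l ++ 0F ∷ []))
    beginning = begin
      plains init ++ plain y ∷ plain x′ ∷ []           ≡⟨ map-++ _ init (y ∷ x′ ∷ []) ⟨
      plains (init ++ y ∷ x′ ∷ [])                     ≡⟨ cong plains (++-assoc init (y ∷ []) (x′ ∷ [])) ⟨
      plains ((init ++ y ∷ []) ++ x′ ∷ [])             ≡⟨ cong (λ bs → plains (bs ++ x′ ∷ [])) (trans (sym (reverse-first l)) (sym (reverse-pad l))) ⟩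
      plains (reverse (l ++ 0F ∷ []) ++ x′ ∷ [])       ≡⟨ cong plains (unfold-reverse x′ (l ++ 0F ∷ [])) ⟨
      plains (reverse (x′ ∷ l ++ 0F ∷ []))             ∎
      where open ≡-Reasoning
    written : ∀ D′ → D′ ≡ D → ∀ {c h} →
      Located h (just (ask (control q′ after 0F 0F)))
        (queueWord c (flat (((plains r ++ end ∷ []) ++ plains init) ++ around D′ y x′))) →
      Pass Q (suc (length r)) h (ready q′) (queueOf (nextʷ x′ D′ w))
    written L refl lo₂ = pass-queue
      (trans (++-assoc (plains init) (hat ∷ plain y ∷ plain x′ ∷ []) _)
        (cong (λ ss → plains init ++ hat ∷ plain y ∷ plain x′ ∷ ss) (plains-pad r)))
      (copying r (plains init ++ hat ∷ plain y ∷ plain x′ ∷ []) (short₂ _ _ _) (relocate (cong flat (turned _)) lo₂))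
    written R refl lo₂ = pass-queue
      (begin
        (plains init ++ plain y ∷ plain x′ ∷ hat ∷ []) ++ plains r ++ plain 0F ∷ end ∷ []
          ≡⟨ ++-assoc (plains init) (plain y ∷ plain x′ ∷ hat ∷ []) _ ⟩
        plains init ++ (plain y ∷ plain x′ ∷ []) ++ hat ∷ plains r ++ plain 0F ∷ end ∷ []
          ≡⟨ ++-assoc (plains init) (plain y ∷ plain x′ ∷ []) _ ⟨
        (plains init ++ plain y ∷ plain x′ ∷ []) ++ hat ∷ plains r ++ plain 0F ∷ end ∷ []
          ≡⟨ cong₂ (λ ss ss′ → ss ++ hat ∷ ss′) beginning ending ⟩
        queueOf (nextʷ x′ R w)
          ∎)
      (copying r (plains init ++ plain y ∷ plain x′ ∷ hat ∷ []) (short₂ _ _ _) (relocate (cong flat (turned _)) lo₂))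
      where open ≡-Reasoning

-- Encoding and decoding transducers

spelled : List Symbol → List (Letter ⊤)
spelled ss = map inj₁ (cells₂ (flat ss))

cells₂-++ : ∀ as bs → cells₂ (as ++ bs) ≡ cells₂ as ++ cells₂ bs
cells₂-++ []        bs = refl
cells₂-++ (0F ∷ as) bs = cong (λ cs → 0F ∷ 1F ∷ cs) (cells₂-++ as bs)
cells₂-++ (1F ∷ as) bs = cong (λ cs → 1F ∷ 0F ∷ cs) (cells₂-++ as bs)

spelled-++ : ∀ ss ss′ → spelled (ss ++ ss′) ≡ spelled ss ++ spelled ss′
spelled-++ ss ss′ = trans (cong (λ bs → map inj₁ (cells₂ bs)) (flat-++ ss ss′))
  (trans (cong (map inj₁) (cells₂-++ (flat ss) (flat ss′))) (map-++ inj₁ (cells₂ (flat ss)) (cells₂ (flat ss′))))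

ʳ++-map : ∀ {A B : Set} (f : A → B) l r → map f l ʳ++ r ≡ map f (reverse l) ++ r
ʳ++-map f l r = trans (ʳ++-defn (map f l)) (cong (_++ r) (sym (reverse-map f l)))

symbols : Letter ⊤ → List Symbol
symbols (inj₁ b)       = plain b ∷ []
symbols (inj₂ (_ , b)) = hat ∷ plain b ∷ []

-- The marked pair put in front is the dummy consumed pair of `queueWord 0`. It is emitted with the
-- first letter, which exists because a spelled word contains its head.
encoder : Transducer (Letter ⊤) (Letter ⊤)
encoder = record
  { size  = 2
  ; start = 0F
  ; next  = λ { 0F x → just (1F , inj₂ (tt , 1F) ∷ inj₁ 1F ∷ spelled (symbols x))
              ; 1F x → just (1F , spelled (symbols x)) }
  ; final = λ { 0F → nothing
              ; 1F → just (spelled (end ∷ [])) }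
  }

encoder-continues : ∀ xs → Transducer.runFrom encoder 1F xs ≡ just (spelled (concatMap symbols xs ++ end ∷ []))
encoder-continues []       = refl
encoder-continues (x ∷ xs) rewrite encoder-continues xs =
  cong just (trans (sym (spelled-++ (symbols x) _)) (cong spelled (sym (++-assoc (symbols x) (concatMap symbols xs) (end ∷ [])))))

encoder-starts : ∀ x xs → Transducer.run encoder (x ∷ xs) ≡
                 just (inj₂ (tt , 1F) ∷ inj₁ 1F ∷ spelled (concatMap symbols (x ∷ xs) ++ end ∷ []))
encoder-starts x xs rewrite encoder-continues xs =
  cong (λ ys → just (inj₂ (tt , 1F) ∷ inj₁ 1F ∷ ys))
    (trans (sym (spelled-++ (symbols x) _)) (cong spelled (sym (++-assoc (symbols x) (concatMap symbols xs) (end ∷ [])))))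

symbols-plains : ∀ bs → concatMap symbols (map inj₁ bs) ≡ plains bs
symbols-plains []       = refl
symbols-plains (b ∷ bs) = cong (plain b ∷_) (symbols-plains bs)

symbols-spell : ∀ w → concatMap symbols (spell tt w) ++ end ∷ [] ≡ queueOf w
symbols-spell (word l x r) = begin
  concatMap symbols (map inj₁ l ʳ++ inj₂ (tt , x) ∷ map inj₁ r) ++ end ∷ []
    ≡⟨ cong (λ xs → concatMap symbols xs ++ end ∷ []) (ʳ++-map inj₁ l (inj₂ (tt , x) ∷ map inj₁ r)) ⟩
  concatMap symbols (map inj₁ (reverse l) ++ inj₂ (tt , x) ∷ map inj₁ r) ++ end ∷ []
    ≡⟨ cong (_++ end ∷ []) (concatMap-++ symbols (map inj₁ (reverse l)) (inj₂ (tt , x) ∷ map inj₁ r)) ⟩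
  (concatMap symbols (map inj₁ (reverse l)) ++ hat ∷ plain x ∷ concatMap symbols (map inj₁ r)) ++ end ∷ []
    ≡⟨ cong₂ (λ ss ss′ → (ss ++ hat ∷ plain x ∷ ss′) ++ end ∷ []) (symbols-plains (reverse l)) (symbols-plains r) ⟩
  (plains (reverse l) ++ hat ∷ plain x ∷ plains r) ++ end ∷ []
    ≡⟨ ++-assoc (plains (reverse l)) (hat ∷ plain x ∷ plains r) (end ∷ []) ⟩
  queueOf (word l x r)
    ∎
  where open ≡-Reasoning

encodes : ∀ w → Transducer.run encoder (spell tt w) ≡ just (spell tt (queueWord 0 (flat (queueOf w))))
encodes w@(word l x r) = trans (nonempty (reverse l) (ʳ++-map inj₁ l (inj₂ (tt , x) ∷ map inj₁ r)))
  (cong (λ ss → just (inj₂ (tt , 1F) ∷ inj₁ 1F ∷ spelled ss)) (symbols-spell w))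
  where
  nonempty : ∀ bs → spell tt w ≡ map inj₁ bs ++ inj₂ (tt , x) ∷ map inj₁ r →
             Transducer.run encoder (spell tt w) ≡ just (inj₂ (tt , 1F) ∷ inj₁ 1F ∷ spelled (concatMap symbols (spell tt w) ++ end ∷ []))
  nonempty []       e rewrite e = encoder-starts (inj₂ (tt , x)) (map inj₁ r)
  nonempty (b ∷ bs) e rewrite e = encoder-starts (inj₁ b) (map inj₁ bs ++ inj₂ (tt , x) ∷ map inj₁ r)

module Decoder {S : Set} (q : S) where

  -- The position (among consumed cells, on the second cell of the last
  -- consumed letter, or on one of the four cells of a symbol), whether the last
  -- symbol was hat, and the first cell of the current symbol.
  Mode : Set
  Mode = Fin 6 × Bit × Bit × Fin 1

  letter : Bit → Bit → Letter S
  letter 0F b = inj₁ b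
  letter 1F b = inj₂ (q , b)

  -- Of each pair only the first cell is used, since it equals the bit.
  nextMode : Mode → Letter ⊤ → Maybe (Mode × List (Letter S))
  nextMode (0F , _)          (inj₁ _) = just ((0F , 0F , 0F , 0F) , [])
  nextMode (0F , _)          (inj₂ _) = just ((1F , 0F , 0F , 0F) , [])
  nextMode (1F , _)          (inj₁ _) = just ((2F , 0F , 0F , 0F) , [])
  nextMode (2F , h , _)      (inj₁ a) = just ((3F , h , a , 0F) , [])
  nextMode (3F , h , a , _)  (inj₁ _) = just ((4F , h , a , 0F) , [])
  nextMode (4F , h , 0F , _) (inj₁ b) = just ((5F , 0F , 0F , 0F) , letter h b ∷ [])
  -- `hat` and `end` differ in their second half, which thus serves as the flag for the next symbol.
  nextMode (4F , h , 1F , _) (inj₁ b) = just ((5F , b , 0F , 0F) , [])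
  nextMode (5F , h , _)      (inj₁ _) = just ((2F , h , 0F , 0F) , [])
  nextMode _                 (inj₂ _) = nothing

  index : Mode → Fin (6 * (2 * (2 * 1)))
  index (i , j , k , l) = pack i j k l

  decoder : Transducer (Letter ⊤) (Letter S)
  decoder = record
    { size  = 6 * (2 * (2 * 1))
    ; start = index (0F , 0F , 0F , 0F)
    ; next  = λ i x → Maybe.map (map₁ index) (nextMode (unpack 6 2 2 1 i) x)
    ; final = λ _ → just []
    }

  open Transducer decoder using (runFrom)

  record Decodes (m : Mode) (xs : List (Letter ⊤)) (o : List (Letter S)) : Set where
    constructor decoded
    field
      output : runFrom (index m) xs ≡ just o

  advance : ∀ m x xs {m′ o o′} → nextMode m x ≡ just (m′ , o) → Decodes m′ xs o′ →
            Decodes m (x ∷ xs) (o ++ o′)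
  advance (i , j , k , l) x xs {m′} {o} e (decoded e′) = decoded (begin
    runFrom (pack i j k l) (x ∷ xs)
      ≡⟨ cong (λ m → Maybe.map (map₁ index) (nextMode m x) >>= continue) (unpack-pack i j k l) ⟩
    (Maybe.map (map₁ index) (nextMode (i , j , k , l) x) >>= continue)
      ≡⟨ cong (λ r → Maybe.map (map₁ index) r >>= continue) e ⟩
    (runFrom (index m′) xs >>= λ o′ → just (o ++ o′))
      ≡⟨ cong (_>>= λ o′ → just (o ++ o′)) e′ ⟩
    just (o ++ _)
      ∎)
    where
    open ≡-Reasoning
    continue : Fin (6 * (2 * (2 * 1))) × List (Letter S) → Maybe (List (Letter S))
    continue (i′ , out) = runFrom i′ xs >>= λ out′ → just (out ++ out′)

  ready-mode : Bit → Mode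
  ready-mode h = 2F , h , 0F , 0F

  decode-plain : ∀ h b ss {o} → Decodes (ready-mode 0F) (spelled ss) o →
                 Decodes (ready-mode h) (spelled (plain b ∷ ss)) (letter h b ∷ o)
  decode-plain h 0F ss e = advance (ready-mode h) _ _ refl (advance (3F , h , 0F , 0F) _ _ refl
    (advance (4F , h , 0F , 0F) _ _ refl (advance (5F , 0F , 0F , 0F) _ _ refl e)))
  decode-plain h 1F ss e = advance (ready-mode h) _ _ refl (advance (3F , h , 0F , 0F) _ _ refl
    (advance (4F , h , 0F , 0F) _ _ refl (advance (5F , 0F , 0F , 0F) _ _ refl e)))

  decode-hat : ∀ ss {o} → Decodes (ready-mode 1F) (spelled ss) o →
               Decodes (ready-mode 0F) (spelled (hat ∷ ss)) o
  decode-hat ss e = advance (ready-mode 0F) _ _ refl (advance (3F , 0F , 1F , 0F) _ _ refl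
    (advance (4F , 0F , 1F , 0F) _ _ refl (advance (5F , 1F , 0F , 0F) _ _ refl e)))

  decode-end : Decodes (ready-mode 0F) (spelled (end ∷ [])) []
  decode-end = advance (ready-mode 0F) _ _ refl (advance (3F , 0F , 1F , 0F) _ _ refl
    (advance (4F , 0F , 1F , 0F) _ _ refl (advance (5F , 0F , 0F , 0F) _ _ refl (decoded refl))))

  decode-plains : ∀ bs ss {o} → Decodes (ready-mode 0F) (spelled ss) o →
                  Decodes (ready-mode 0F) (spelled (plains bs ++ ss)) (map inj₁ bs ++ o)
  decode-plains []       ss e = e
  decode-plains (b ∷ bs) ss e = decode-plain 0F b (plains bs ++ ss) (decode-plains bs ss e)

  decode-queue : ∀ w → Decodes (ready-mode 0F) (spelled (queueOf w)) (spell q w)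
  decode-queue (word l x r) = subst (Decodes (ready-mode 0F) (spelled (queueOf (word l x r))))
    (trans (cong (λ xs → map inj₁ (reverse l) ++ inj₂ (q , x) ∷ xs) (++-identityʳ (map inj₁ r)))
      (sym (ʳ++-map inj₁ l (inj₂ (q , x) ∷ map inj₁ r))))
    (decode-plains (reverse l) (hat ∷ plain x ∷ plains r ++ end ∷ [])
      (decode-hat (plain x ∷ plains r ++ end ∷ []) (decode-plain 1F x (plains r ++ end ∷ [])
        (decode-plains r (end ∷ []) decode-end))))

  decode-consumed : ∀ bs xs {o} → Decodes (0F , 0F , 0F , 0F) xs o → Decodes (0F , 0F , 0F , 0F) (map inj₁ bs ++ xs) o
  decode-consumed []       xs e = e
  decode-consumed (b ∷ bs) xs e = advance (0F , 0F , 0F , 0F) (inj₁ b) (map inj₁ bs ++ xs) refl (decode-consumed bs xs e)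

  decodes : ∀ c w → Transducer.run decoder (spell tt (queueWord c (flat (queueOf w)))) ≡ just (spell q w)
  decodes c w = trans (cong (Transducer.run decoder) (ʳ++-map inj₁ (replicate c 1F) _))
    (Decodes.output (decode-consumed (reverse (replicate c 1F)) (inj₂ (tt , 1F) ∷ inj₁ 1F ∷ spelled (queueOf w))
      (advance (0F , 0F , 0F , 0F) (inj₂ (tt , 1F)) (inj₁ 1F ∷ spelled (queueOf w)) refl
        (advance (1F , 0F , 0F , 0F) (inj₁ 1F) (spelled (queueOf w)) refl (decode-queue w)))))

-- Sizes of words and the cubic bound

length-drop-pad : ∀ (l : List Bit) → length (drop 1 (l ++ 0F ∷ [])) ≡ length l
length-drop-pad []      = refl
length-drop-pad (x ∷ l) = trans (length-++ l) (+-comm (length l) 1)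

length-pad : ∀ (l : List Bit) → length (l ++ 0F ∷ []) ≡ suc (length l)
length-pad l = trans (length-++ l) (+-comm (length l) 1)

last-snoc : ∀ (l : List Bit) x → last (l ++ x ∷ []) ≡ just x
last-snoc []          x = refl
last-snoc (_ ∷ [])    x = refl
last-snoc (_ ∷ y ∷ l) x = last-snoc (y ∷ l) x

last-ones : ∀ k → last (replicate {A = Bit} k 1F) ≢ just 0F
last-ones (suc zero)    ()
last-ones (suc (suc k)) e = last-ones (suc k) e

-- `end` is written `1001`, which closes the word with a mark even where the simulated tape ends in
-- padding blanks.
last-queue : ∀ w → last (1F ∷ cells₂ (flat (queueOf w))) ≡ just 1F
last-queue (word l x r) = trans (cong last (begin
  1F ∷ cells₂ (flat (plains (reverse l) ++ hat ∷ plain x ∷ plains r ++ end ∷ []))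
    ≡⟨ cong (λ ss → 1F ∷ cells₂ (flat ss)) (++-assoc (plains (reverse l)) (hat ∷ plain x ∷ plains r) (end ∷ [])) ⟨
  1F ∷ cells₂ (flat (body ++ end ∷ []))
    ≡⟨ cong (λ bs → 1F ∷ cells₂ bs) (flat-++ body (end ∷ [])) ⟩
  1F ∷ cells₂ (flat body ++ 1F ∷ 0F ∷ [])
    ≡⟨ cong (1F ∷_) (cells₂-++ (flat body) (1F ∷ 0F ∷ [])) ⟩
  1F ∷ cells₂ (flat body) ++ (1F ∷ 0F ∷ 0F ∷ []) ++ 1F ∷ []
    ≡⟨ ++-assoc (1F ∷ cells₂ (flat body)) (1F ∷ 0F ∷ 0F ∷ []) (1F ∷ []) ⟨
  (1F ∷ cells₂ (flat body) ++ 1F ∷ 0F ∷ 0F ∷ []) ++ 1F ∷ []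
    ∎)) (last-snoc (1F ∷ cells₂ (flat body) ++ 1F ∷ 0F ∷ 0F ∷ []) 1F)
  where
  open ≡-Reasoning
  body = plains (reverse l) ++ hat ∷ plain x ∷ plains r

queueWord-trimmed : ∀ k w → Trimmed (queueWord k (flat (queueOf w)))
queueWord-trimmed k w = last-ones k , λ e → case trans (sym (last-queue w)) e of λ ()

nth-last : ∀ x l → last (x ∷ l) ≢ just 0F → nth (x ∷ l) (length l) ≡ 1F
nth-last 0F []      t = ⊥-elim (t refl)
nth-last 1F []      t = refl
nth-last x  (y ∷ l) t = nth-last y l t

-- The outermost letter on a nonempty side of a trimmed word is a 1, hence lies in the window, as
-- the head does. Each side therefore has length at most `t`.
module Extent (w : Word) (T : Tape) (trimmed : Trimmed w) (d : w describes T) (a : ℤ) (t : ℕ)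
              (window : ∀ z → cells T z ≡ 1F → a ℤ.≤ z × z ℤ.< a ℤ.+ ⁺ t)
              (a≤h : a ℤ.≤ head T) (h< : head T ℤ.< a ℤ.+ ⁺ t) where

  below : ∀ {k} → a ℤ.+ ⁺ k ℤ.< a ℤ.+ ⁺ t → k < t
  below p = ≰⇒> λ t≤k → ℤ.<⇒≱ p (ℤ.+-monoʳ-≤ a (ℤ.+≤+ t≤k))

  0<t : 0 < t
  0<t = below (ℤ.≤-<-trans (ℤ.≤-trans (ℤ.≤-reflexive (ℤ.+-identityʳ a)) a≤h) h<)

  left-≤ : ∀ l → last l ≢ just 0F → (∀ n → cells T (head T ℤ.+ -[1+ n ]) ≡ nth l n) → length l ≤ t
  left-≤ []      _ _ = z≤n
  left-≤ (x ∷ l) t′ e = <⇒≤ (below (ℤ.≤-<-trans (ℤ.≤-trans (ℤ.+-monoˡ-≤ (⁺ suc (length l))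
      (proj₁ (window _ (trans (e (length l)) (nth-last x l t′))))) (ℤ.≤-reflexive back)) h<))
    where
    back : head T ℤ.+ -[1+ length l ] ℤ.+ ⁺ suc (length l) ≡ head T
    back = trans (ℤ.+-assoc (head T) -[1+ length l ] (⁺ suc (length l)))
      (trans (cong (λ z → head T ℤ.+ z) (ℤ.+-inverseˡ (⁺ suc (length l)))) (ℤ.+-identityʳ (head T)))

  right-≤ : ∀ r → last r ≢ just 0F → (∀ n → cells T (head T ℤ.+ ⁺ suc n) ≡ nth r n) → length r ≤ t
  right-≤ []      _ _ = z≤n
  right-≤ (x ∷ r) t′ e = <⇒≤ (below (ℤ.≤-<-trans (ℤ.+-monoˡ-≤ (⁺ suc (length r)) a≤h)
      (proj₂ (window _ (trans (e (length r)) (nth-last x r t′))))))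

  total : length (Word.left w) + length (Word.right w) ≤ t + t
  total = +-mono-≤ (left-≤ (Word.left w) (proj₁ trimmed) λ n → d -[1+ n ]) (right-≤ (Word.right w) (proj₂ trimmed) λ n → d (⁺ suc n))

-- Since `t` is positive, constants are absorbed into linear terms: `7 = 3 + 4` and `8 = 4 + 4`.
cubic : ∀ p q k t → 0 < t → t * ((3 + 4 * t) * ((p + q * (4 + 4 * t)) * k)) ≤ 7 * (p + q * 8) * k * t ^ 3
cubic p q k t 0<t = begin
  t * ((3 + 4 * t) * ((p + q * (4 + 4 * t)) * k))
    ≤⟨ *-monoʳ-≤ t (*-mono-≤ (absorb 3 4) (*-monoˡ-≤ k (+-monoʳ-≤ p (*-monoʳ-≤ q (absorb 4 4))))) ⟩
  t * (7 * t * ((p + q * (8 * t)) * k))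
    ≡⟨ cong (λ j → t * (7 * t * ((p + j) * k))) (*-assoc q 8 t) ⟨
  t * (7 * t * ((p + q * 8 * t) * k))
    ≤⟨ *-monoʳ-≤ t (*-monoʳ-≤ (7 * t) (*-monoˡ-≤ k (absorb p (q * 8)))) ⟩
  t * (7 * t * ((p + q * 8) * t * k))
    ≡⟨ solve 3 (λ c k t → t :* (con 7 :* t :* (c :* t :* k)) := con 7 :* c :* k :* (t :* (t :* (t :* con 1))))
         refl (p + q * 8) k t ⟩
  7 * (p + q * 8) * k * t ^ 3
    ∎
  where
  open ≤-Reasoning
  open +-*-Solver
  absorb : ∀ a b → a + b * t ≤ (a + b) * t
  absorb a b = subst₂ _≤_ (cong (λ k → k + b * t) (*-identityʳ a)) (sym (*-distribʳ-+ t a b)) (+-monoˡ-≤ (b * t) (*-monoʳ-≤ a 0<t))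

-- Correctness and running time

module Correctness (M : BinaryTM) where

  open BinaryTM M
  open Simulation M

  halted : ∀ {q b} → f q b ≡ nothing → q ≡ halt
  halted = Equivalence.to (f-undefined _ _)

  stuck : ∀ {q b} → q ≡ halt → f q b ≡ nothing
  stuck = Equivalence.from (f-undefined _ _)

  ready-halt : ready halt ≡ nothing
  ready-halt = cong (Maybe.map _) (stuck refl)

  ready-running : ∀ {q b r} → f q b ≡ just r → ready q ≡ just (control q before 0F 0F)
  ready-running {q} e with f q 0F in e₀
  ... | just _  = refl
  ... | nothing with () ← trans (sym e) (stuck (halted e₀))

  control-injective : ∀ {q q′} → label (just (control q before 0F 0F)) ≡ label (just (control q′ before 0F 0F)) → q ≡ q′
  control-injective {q} {q′} e = cong proj₁ (begin
    (q , before , 0F , 0F)                      ≡⟨ unpack-pack q before 0F 0F ⟨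
    uncontrol (control q before 0F 0F)          ≡⟨ cong (λ x → uncontrol (proj₂ x)) (blockOf-ask (control q before 0F 0F)) ⟨
    uncontrol (proj₂ (blockOf (ask (control q before 0F 0F))))   ≡⟨ cong (λ i → uncontrol (proj₂ (blockOf i))) (just-injective e) ⟩
    uncontrol (proj₂ (blockOf (ask (control q′ before 0F 0F))))  ≡⟨ cong (λ x → uncontrol (proj₂ x)) (blockOf-ask (control q′ before 0F 0F)) ⟩
    uncontrol (control q′ before 0F 0F)         ≡⟨ unpack-pack q′ before 0F 0F ⟩
    (q′ , before , 0F , 0F)                     ∎)
    where open ≡-Reasoning

  ready-injective : ∀ q q′ → label (ready q) ≡ label (ready q′) → q ≡ q′
  ready-injective q q′ e with f q 0F in e₁ | f q′ 0F in e₂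
  ... | nothing | nothing = trans (halted e₁) (sym (halted e₂))
  ... | just _  | just _  = control-injective e
  ready-injective q q′ () | nothing | just _
  ready-injective q q′ () | just _  | nothing

  entrance : State → Fin (suc lastCell)
  entrance q = location (label (ready q))

  -- Inverts `entrance` by search, with default `q₀` away from the entrances. The helper `found` has
  -- a name so that `stateAt-entrance` can treat an arbitrary outcome of the search.
  stateAt : Fin (suc lastCell) → State
  stateAt p = found (any? λ q → entrance q ≟ᶠ p)
    module StateAt where
    found : Dec (∃[ q ] entrance q ≡ p) → State
    found (yes (q , _)) = q
    found (no _)        = q₀

  stateAt-entrance : ∀ q → stateAt (entrance q) ≡ q
  stateAt-entrance q = lemma (any? λ q′ → entrance q′ ≟ᶠ entrance q)
    where
    lemma : ∀ d → StateAt.found (entrance q) d ≡ q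
    lemma (yes (q′ , e)) = ready-injective q′ q (location-injective _ _ e)
    lemma (no ¬e)        = ⊥-elim (¬e (q , refl))

  coding : Coding M
  coding = record
    { P      = P
    ; C      = C
    ; pHead₀ = entrance q₀
    ; cHead₀ = 0F
    ; ε      = encoder
    ; δ      = λ _ p _ → Decoder.decoder (stateAt p)
    ; signal = signalled
    }

  open Coding coding using (DecodesTo; SimulatesRun; initial)

  encoded : ℕ → Word → Word
  encoded c w = queueWord c (flat (queueOf w))

  record Represents (h : HConfig) (c : Config) (w : Word) : Set where
    constructor represents
    field
      {consumed} : ℕ
      isLocated  : Located h (label (ready (state c))) (encoded consumed w)
      tape≡      : w describes work c

  cost : ℕ → ℕ
  cost e = (3 + e) * unit (4 + e)

  extent-next : ∀ x D w → extent (nextʷ x D w) ≡ 2 + extent w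
  extent-next x L (word l y r) = trans (cong₂ (λ i j → i + suc j) (length-drop-pad l) (length-pad r))
    (trans (+-suc (length l) (suc (length r))) (cong suc (+-suc (length l) (length r))))
  extent-next x R (word l y r) = cong₂ (λ i j → suc i + j) (length-pad l) (length-drop-pad r)

  record Stepped (h : HConfig) (c′ : Config) (w : Word) : Set where
    constructor stepped
    field
      {lasting} : ℕ
      {word′}   : Word
      within    : suc lasting ≤ cost (extent w)
      reached   : Represents (hrun h (suc lasting)) c′ word′
      silent    : QuietBefore (suc lasting) h
      grown     : extent word′ ≡ 2 + extent w

  describes-pad : ∀ w T → w describes T → pad w describes T
  describes-pad (word l x r) T d z = trans (d z) (sym (layout-pad 1 1 l x r z))

  passed⇒stepped : ∀ {h q} T w x D → Pass (4 + extent w) (3 + extent w) h (ready q) (queueOf (nextʷ x D w)) →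
    w describes T → Stepped h (config q (move D (Defs.write x T))) w
  passed⇒stepped T w x D (passed (run b lo quiet)) d = stepped b
    (represents lo (describes-move D (writeʷ x (pad w)) (Defs.write x T) (describes-write x (pad w) T (describes-pad w T d))))
    quiet (extent-next x D w)

  apply : Tape → Maybe (Bit × Direction × State) → Maybe Config
  apply T r = r >>= λ (x , D , q′) → just (config q′ (move D (Defs.write x T)))

  step-by : ∀ {h c w c′} r → Represents h c w → f (state c) (Word.under w) ≡ r →
            apply (work c) r ≡ just c′ → Stepped h c′ w
  step-by {w = w} (just (x , D , q′)) (represents {k} lo d) e refl = passed⇒stepped _ w x D
    (simulate w e (subst (λ s → Located _ (label s) (encoded k w)) (ready-running e) lo)) d

  machine-step : ∀ {h c w c′} → Represents h c w → step c ≡ just c′ → Stepped h c′ w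
  machine-step {c = config q T} {w} {c′} rep e = step-by (f q (Word.under w)) rep refl
    (subst (λ b → apply T (f q b) ≡ just c′) (read-described w T (Represents.tape≡ rep)) e)

  decoded : ∀ {h c w} → Represents h c w → DecodesTo h c
  decoded {c = c} {w} (represents {k} (located _ p≡ _ d) d′) =
      encoded k w , w , queueWord-trimmed k w , d
    , subst (λ q → Transducer.run (Decoder.decoder q) (spell tt (encoded k w)) ≡ just (spell (state c) w))
        (sym (trans (cong stateAt p≡) (stateAt-entrance (state c)))) (Decoder.decodes (state c) k w)
    , d′

  unit-mono : ∀ {Q Q′} → Q ≤ Q′ → unit Q ≤ unit Q′
  unit-mono {Q} {Q′} p = subst₂ _≤_ (sym (unit≡ Q)) (sym (unit≡ Q′)) (*-monoˡ-≤ κ (+-monoʳ-≤ 88 (*-monoʳ-≤ 32 p)))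

  cost-mono : ∀ {e e′} → e ≤ e′ → cost e ≤ cost e′
  cost-mono p = *-mono-≤ (+-monoʳ-≤ 3 p) (unit-mono (+-monoʳ-≤ 4 p))

  opaque
    K : ℕ
    K = 7 * (88 + 32 * 8) * κ

    cost-bound : ∀ t → 0 < t → t * cost (4 * t) ≤ K * t ^ 3
    cost-bound t 0<t = subst (λ u → t * ((3 + 4 * t) * u) ≤ K * t ^ 3) (sym (unit≡ (4 + 4 * t))) (cubic 88 32 κ t 0<t)

  module FromStart (c₀ : Config) (w₀ : Word) (start≡ : state c₀ ≡ q₀) (trimmed : Trimmed w₀) (d₀ : w₀ describes work c₀) where

    h₀ : HConfig
    h₀ = initial (encoded 0 w₀)

    -- In `soon` all `i` passes are charged at the present extent, the largest so far.
    record Progress (i t : ℕ) (c : Config) : Set where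
      constructor progress
      field
        {tapeWord} : Word
        represented : Represents (hrun h₀ t) c tapeWord
        size≡       : extent tapeWord ≡ i * 2 + extent w₀
        silent      : QuietBefore t h₀
        late        : i ≤ t
        soon        : t ≤ i * cost (i * 2 + extent w₀)

    beginning : Progress 0 0 c₀
    beginning = progress
      (represents {consumed = 0} (located refl (cong entrance (sym start≡)) refl (λ z → cong (layout (encoded 0 w₀)) (ℤ.+-identityˡ z))) d₀)
      refl (λ _ ()) z≤n z≤n

    continue : ∀ {i t c c′} (p : Progress i t c) (s : Stepped (hrun h₀ t) c′ (Progress.tapeWord p)) →
               Progress (suc i) (t + suc (Stepped.lasting s)) c′
    continue {i} {t} {c′ = c′} (progress {w} _ e q l b) (stepped {u} {w′} b′ r q′ e′) = progress
      (subst (λ h → Represents h c′ w′) (sym (hrun-+ h₀ t (suc u))) r)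
      (trans e′ (cong (λ k → 2 + k) e))
      (QuietBefore-+ t (suc u) q q′)
      (subst (suc i ≤_) (sym (+-suc t u)) (s≤s (≤-trans l (m≤m+n t u))))
      (begin
        t + suc u                                   ≤⟨ +-mono-≤ b b′ ⟩
        i * cost E + cost (extent w)                ≡⟨ cong (λ e → i * cost E + cost e) e ⟩
        i * cost E + cost E                         ≡⟨ +-comm (i * cost E) (cost E) ⟩
        suc i * cost E                              ≤⟨ *-monoʳ-≤ (suc i) (cost-mono (m≤n+m E 2)) ⟩
        suc i * cost (2 + E)                        ∎)
      where
      open ≤-Reasoning
      E = i * 2 + extent w₀

    -- Vacuous once the trace has ended, which allows `time` to be a total function.
    Stage : ℕ → ℕ → Maybe Config → Set
    Stage i t mc = ∀ c → mc ≡ just c → Progress i t c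

    after-step : ∀ {i t c} → Progress i t c → ∀ mc′ → step c ≡ mc′ →
                 Σ[ t′ ∈ ℕ ] (Is-just mc′ → t < t′) × Stage (suc i) t′ mc′
    after-step {t = t} p nothing   e = t , (λ ()) , λ _ ()
    after-step {t = t} p (just c′) e = t + suc (Stepped.lasting s) , (λ _ → m<m+n t (s≤s z≤n)) , λ { _ refl → continue p s }
      where s = machine-step (Progress.represented p) e

    next-stage : ∀ {i t} mc → Stage i t mc → Σ[ t′ ∈ ℕ ] (Is-just (mc >>= step) → t < t′) × Stage (suc i) t′ (mc >>= step)
    next-stage {t = t} nothing  p = t , (λ ()) , λ _ ()
    next-stage         (just c) p = after-step (p c refl) (step c) refl

    time : ℕ → ℕ
    stage : ∀ i → Stage i (time i) (trace c₀ i)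

    time zero    = 0
    time (suc i) = proj₁ (next-stage (trace c₀ i) (stage i))

    stage zero    _ refl = beginning
    stage (suc i) = proj₂ (proj₂ (next-stage (trace c₀ i) (stage i)))

    located-halt : ∀ i → (e : HaltsAt c₀ i) → ∃[ k ] ∃[ w ] Located (hrun h₀ (time i)) nothing (encoded k w)
    located-halt i (c , e , halt≡) = consumed , tapeWord , subst (λ s → Located (hrun h₀ (time i)) s (encoded consumed tapeWord))
      (trans (cong (λ q → label (ready q)) halt≡) (cong label ready-halt)) isLocated
      where
      open Progress (stage i c e)
      open Represents represented

    signals : ∀ i → HaltsAt c₀ i → FirstReaches signalled h₀ (time i)
    signals i halts@(c , e , _) =
      let (_ , _ , lo) = located-halt i halts
      in  (Located.isq₁ lo , trans (Located.atEntry lo) location-nothing) , Progress.silent (stage i c e)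

    undefined⇒Halts : ∀ i → trace c₀ i ≡ nothing → Halts c₀
    undefined⇒Halts (suc i) e = by-trace (trace c₀ i) refl e
      where
      by-apply : ∀ {T} r → apply T r ≡ nothing → r ≡ nothing
      by-apply nothing  _ = refl
      by-trace : ∀ mc → trace c₀ i ≡ mc → (mc >>= step) ≡ nothing → Halts c₀
      by-trace nothing  e′ _  = undefined⇒Halts i e′
      by-trace (just c) e′ e″ = i , c , e′ , halted (by-apply {work c} _ e″)

    -- If `M` were still running after `s + 1` steps, `late` would put the corresponding time beyond
    -- `s`, and no signal precedes that time. So the trace has ended by then.
    signal⇒Halts : ∃ (FirstReaches signalled h₀) → Halts c₀
    signal⇒Halts (s , hit , _) = by-trace (trace c₀ (suc s)) refl
      where
      by-trace : ∀ mc → trace c₀ (suc s) ≡ mc → Halts c₀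
      by-trace nothing  e = undefined⇒Halts (suc s) e
      by-trace (just c) e = ⊥-elim (Progress.silent p s (Progress.late p) hit)
        where p = stage (suc s) c e

    loops : ∀ s → FirstReaches signalled h₀ s → LoopsFrom h₀ s
    loops s reached =
      let (i , halts)  = signal⇒Halts (s , reached)
          (_ , _ , lo) = located-halt i halts
      -- The final `refl` says that the head is on a marked cell, that of a consumed pair, so the
      -- self-jump is taken.
      in  subst (LoopsFrom h₀) (FirstReaches-unique (signals i halts) reached) (halted-loops lo refl)

    in-time : ∀ t → RunsInTime c₀ t → ∃[ s ] s ≤ K * t ^ 3 × FirstReaches signalled h₀ s
    in-time t ((i , i≤t , halts@(c , e , _)) , (a , ones , heads)) = time i , bound , signals i halts
      where
      open Extent w₀ (work c₀) trimmed d₀ a t ones (proj₁ (heads 0 c₀ refl)) (proj₂ (heads 0 c₀ refl))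
      open ≤-Reasoning
      bound : time i ≤ K * t ^ 3
      bound = begin
        time i                          ≤⟨ Progress.soon (stage i c e) ⟩
        i * cost (i * 2 + extent w₀)    ≤⟨ *-mono-≤ i≤t (cost-mono (begin
          -- Two padding cells per step on top of an initial extent of at most `t + t`.
          i * 2 + extent w₀               ≤⟨ +-mono-≤ (*-monoˡ-≤ 2 i≤t) total ⟩
          t * 2 + (t + t)                 ≡⟨ solve 1 (λ t → t :* con 2 :+ (t :+ t) := con 4 :* t) refl t ⟩
          4 * t                           ∎)) ⟩
        t * cost (4 * t)                ≤⟨ cost-bound t 0<t ⟩
        K * t ^ 3                       ∎
        where open +-*-Solver

    simulates : SimulatesRun (λ t → K * t ^ 3) c₀ h₀
    simulates = record
      { time      = time
      ; time-mono = λ i → proj₁ (proj₂ (next-stage (trace c₀ i) (stage i)))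
      ; decodes   = λ i c e → decoded (Progress.represented (stage i c e))
      ; halting   = mk⇔ (λ (i , halts) → time i , signals i halts) signal⇒Halts
      ; loops     = loops
      ; in-time   = in-time
      }

theorem2 : (M : BinaryTM) → HSimulates M InTimeO (λ t → t ^ 3)
theorem2 M = coding , K , λ c₀ w start≡ trimmed d →
  encoded 0 w , encodes w , FromStart.simulates c₀ w start≡ trimmed d
  where open Correctness M
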